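{- There exists $n_0$ such that for every $n\ge n_0$, \[ f(n,3,4)=\binom{\lfloor n/3\rfloor}{3}+\binom{\lfloor (n+1)/3\rfloor}{3}+\binom{\lfloor (n+2)/3\rfloor}{3}. \] Moreover, if $G$ is a graph on $n\ge n_0$ vertices with $\alpha(G)\le 3$ and $t_3(G)=f(n,3,4)$, then $G$ contains $\overline{T_{n,3}}$ as a spanning subgraph, i.e. $V(G)$ can be partitioned into three cliques of sizes $\lfloor n/3\rfloor$, $\lfloor (n+1)/3\rfloor$, $\lfloor (n+2)/3\rfloor$.
   Context: $\alpha(G)$ is the independence number of $G$ and $t_3(G)$ the number of triangles of $G$. $f(n,3,4)$ is the minimum of $t_3(G)$ over all $n$-vertex graphs $G$ with $\alpha(G)\le 3$. $\overline{T_{n,3}}$ is the disjoint union of three cliques on $n$ vertices in total with sizes as equal as possible. -}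

module Defs where

open import Data.Nat using (ℕ; zero; suc; _+_; _<_; _/_)
open import Data.Nat.Combinatorics using (_C_)
open import Data.Fin using (Fin; toℕ)
open import Data.Bool using (Bool; true; false; if_then_else_)
open import Data.Nat.ListAction using (sum)
open import Data.List using (List; map; length; filter; allFin)
open import Data.Product using (_×_; Σ; _,_)
open import Relation.Binary.PropositionalEquality using (_≡_; _≢_)
open import Relation.Nullary using (¬_)
open import Relation.Nullary.Decidable using (Dec)

record Graph (n : ℕ) : Set where
  field
    adj   : Fin n → Fin n → Bool
    sym   : ∀ i j → adj i j ≡ adj j i
    irrefl : ∀ i → adj i i ≡ false

open Graph public

Adj : ∀ {n} → Graph n → Fin n → Fin n → Set
Adj G i j = adj G i j ≡ true

IndepSet4 : ∀ {n} → Graph n → Fin n → Fin n → Fin n → Fin n → Set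
IndepSet4 G a b c d =
  a ≢ b × a ≢ c × a ≢ d × b ≢ c × b ≢ d × c ≢ d ×
  ¬ Adj G a b × ¬ Adj G a c × ¬ Adj G a d ×
  ¬ Adj G b c × ¬ Adj G b d × ¬ Adj G c d

αAtMost3 : ∀ {n} → Graph n → Set
αAtMost3 G = ∀ a b c d → ¬ IndepSet4 G a b c d

count : ∀ {n} → (Fin n → ℕ) → ℕ
count {n} f = sum (map f (allFin n))

b2n : Bool → ℕ
b2n true = 1
b2n false = 0

lt : ∀ {n} → Fin n → Fin n → Bool
lt i j = Data.Nat._<ᵇ_ (toℕ i) (toℕ j)

_∧_ : Bool → Bool → Bool
true ∧ b = b
false ∧ _ = false

t3 : ∀ {n} → Graph n → ℕ
t3 {n} G = count λ i → count λ j → count λ k →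
  b2n (lt i j ∧ (lt j k ∧ (adj G i j ∧ (adj G i k ∧ adj G j k))))

-- f(n,3,4) = min { t₃(G) : G on n vertices, α(G) ≤ 3 }.
-- "IsF34 n m" says m is this minimum: attained, and a lower bound.
IsF34 : ℕ → ℕ → Set
IsF34 n m =
  Σ (Graph n) (λ G → αAtMost3 G × t3 G ≡ m) ×
  (∀ (G : Graph n) → αAtMost3 G → m Data.Nat.≤ t3 G)

turanValue : ℕ → ℕ
turanValue n = ((n / 3) C 3) + (((n + 1) / 3) C 3) + (((n + 2) / 3) C 3)

partSize : ℕ → Fin 3 → ℕ
partSize n Fin.zero = n / 3
partSize n (Fin.suc Fin.zero) = (n + 1) / 3
partSize n (Fin.suc (Fin.suc Fin.zero)) = (n + 2) / 3

ContainsCoTuran3 : ∀ {n} → Graph n → Set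
ContainsCoTuran3 {n} G =
  Σ (Fin n → Fin 3) λ c →
    (∀ (p : Fin 3) → length (filter (λ v → c v Data.Fin.≟ p) (allFin n)) ≡ partSize n p) ×
    (∀ u v → u ≢ v → c u ≡ c v → Adj G u v)

{-# OPTIONS --safe #-}

-- Let H be the complement of G, a K₄-free graph.  The number of ordered triples of pairwise equal or G-adjacent
-- vertices is T = 6 t₃ + 3 Σ m(v) - 2 n, where m(v) is the closed degree of v in G.  A flag-algebra certificate on
-- five vertices gives K (9 T - n³) ≥ c Σ (n - 3 m(v))² with c > 0; all tuples, also those with repeated vertices, are
-- counted, so there is no error term.  If t₃ is at most the Turán value, this forces Σ (n - 3 m(v))² = O(n), hence
-- every m(v) is n/3 + O(√n).  A K₄-free graph with minimum degree that close to 2n/3 is 3-colourable: pick a triangle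
-- xyz, let V_x be the common neighbours of y and z, and so on; these sets are independent and of size about n/3, and
-- every vertex has few neighbours in one of them, which is its colour.  So G is covered by three cliques, and
-- convexity of the binomial coefficient finishes the proof.

module Submission where

open import Defs hiding (_∧_) renaming (sym to adj-sym)
open import Data.Bool using (Bool; true; false; not; if_then_else_; _∧_; _∨_; T)
import Data.Bool.Properties as Bool
open import Data.Empty using (⊥; ⊥-elim)
open import Data.Fin using (Fin; zero; suc; toℕ; fromℕ<)
import Data.Fin as Fin
import Data.Fin.Properties as Fin
open import Data.Integer using (ℤ; +_; -[1+_]; _+_; _*_; _-_; -_; _≤_; _<_; +≤+; 0ℤ; 1ℤ)
import Data.Integer.Properties as ℤ
open import Data.Integer.Tactic.RingSolver using (solve-∀)
open import Data.List using (List; []; _∷_; _++_; map; concatMap; length; filter; allFin; tabulate)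
open import Data.List.Properties using (map-tabulate)
open import Data.Nat using (ℕ; zero; suc; z≤n; s≤s; _≥_)
import Data.Nat as ℕ
open import Data.Nat.Combinatorics using (_C_; nCk+nC[k+1]≡[n+1]C[k+1]; nC1≡n)
open import Data.Nat.DivMod using (+-distrib-/-∣ʳ; m*n/n≡m; m≡m%n+[m/n]*n; m%n<n; /-monoˡ-≤)
open import Data.Nat.Divisibility using (n∣m*n; ∣-refl)
import Data.Nat.ListAction as ListAction
import Data.Nat.Properties as ℕ
open import Data.Product using (Σ; _×_; _,_; proj₁; proj₂; ∃-syntax)
open import Data.Sum using (_⊎_; inj₁; inj₂)
open import Data.Vec using (Vec; []; _∷_)
open import Function using (_∘_; id; case_of_)
open import Relation.Binary.PropositionalEquality using (_≡_; _≢_; refl; sym; trans; cong; cong₂; subst; subst₂)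
open import Relation.Nullary using (¬_; Dec; yes; no)
open import Relation.Nullary.Decidable using (⌊_⌋; True; toWitness; ¬?; _×-dec_; _→-dec_)
open import Algebra.Properties.Semiring.Sum ℤ.+-*-semiring using (sum; sum-cong-≗; ∑-distrib-+; ∑-comm; *-distribˡ-sum)

-- The result is exact, so lower-order terms cannot be discarded. Write y(v) = n - 3 m(v). Inserting
-- the formula for T and the Turán bound on t₃ into the certificate cancels the n³ and n² terms,
-- leaving c Σ y² ≤ K (6 n - 9 Σ y). The linear term Σ y has no sign, and completing the square
-- absorbs it. A single y(v)² is at most Σ y² = O(n), so every vertex obeys the degree bound and
-- there are no exceptional vertices to repair afterwards. The numbers come from the colouring step.
-- If every m(v) ≤ B and 3 B ≤ n + δ, it needs 7 δ + 2 B < n. With δ = 3 B - n this reads B < 8 n /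
-- 23, and 25/72 lies just below 8/23; then δ is about n / 24 and 7 δ + 2 B about 71 n / 72. The
-- degree bound 49/144 lies halfway between 24/72 and 25/72, and the remaining half pays for
-- rounding n to a multiple of 72. It amounts to y(v) > - n / 48, and 48² = 2304 is the factor in
-- the threshold `n₀`.

-- Integer sums

-- Opaque, so that unification does not look inside the sums.
opaque
  ∑ : ∀ {n} → (Fin n → ℤ) → ℤ
  ∑ = sum

  ∑-cong : ∀ {n} {f g : Fin n → ℤ} → (∀ i → f i ≡ g i) → ∑ f ≡ ∑ g
  ∑-cong = sum-cong-≗

  ∑-+ : ∀ {n} (f g : Fin n → ℤ) → ∑ (λ i → f i + g i) ≡ ∑ f + ∑ g
  ∑-+ = ∑-distrib-+

  ∑-* : ∀ {n} c (f : Fin n → ℤ) → ∑ (λ i → c * f i) ≡ c * ∑ f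
  ∑-* c f = sym (*-distribˡ-sum c f)

  ∑-swap : ∀ {m n} (f : Fin m → Fin n → ℤ) → ∑ (λ i → ∑ (f i)) ≡ ∑ (λ j → ∑ λ i → f i j)
  ∑-swap = ∑-comm

  ∑-suc : ∀ {n} (f : Fin (suc n) → ℤ) → ∑ f ≡ f zero + ∑ (λ i → f (suc i))
  ∑-suc f = refl

  ∑-empty : (f : Fin 0 → ℤ) → ∑ f ≡ 0ℤ
  ∑-empty f = refl

∑-nonneg : ∀ {n} (f : Fin n → ℤ) → (∀ i → 0ℤ ≤ f i) → 0ℤ ≤ ∑ f
∑-nonneg {zero} f h = ℤ.≤-reflexive (sym (∑-empty f))
∑-nonneg {suc n} f h = subst (0ℤ ≤_) (sym (∑-suc f)) (ℤ.+-mono-≤ (h zero) (∑-nonneg (λ i → f (suc i)) (λ i → h (suc i))))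

∑-const : ∀ n (c : ℤ) → ∑ {n} (λ _ → c) ≡ + n * c
∑-const zero c = trans (∑-empty _) (sym (ℤ.*-zeroˡ c))
∑-const (suc n) c = trans (∑-suc _) (trans (cong (λ x → c + x) (∑-const n c)) (sym (ℤ.suc-* (+ n) c)))

square-nonneg : ∀ x → 0ℤ ≤ x * x
square-nonneg (+ n) = subst (0ℤ ≤_) (ℤ.pos-* n n) (+≤+ z≤n)
square-nonneg -[1+ n ] = +≤+ z≤n

*-nonneg : ∀ {x y} → 0ℤ ≤ x → 0ℤ ≤ y → 0ℤ ≤ x * y
*-nonneg {+ m} {+ n} _ _ = subst (0ℤ ≤_) (ℤ.pos-* m n) (+≤+ z≤n)

∑-product : ∀ {m n} (f : Fin m → ℤ) (g : Fin n → ℤ) → ∑ (λ i → ∑ λ j → f i * g j) ≡ ∑ f * ∑ g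
∑-product f g = trans
  (∑-cong λ i → trans (∑-* (f i) g) (ℤ.*-comm (f i) (∑ g)))
  (trans (∑-* (∑ g) f) (ℤ.*-comm (∑ g) (∑ f)))

∑∑-product : ∀ {k l m n} (f : Fin k → Fin l → ℤ) (g : Fin m → Fin n → ℤ) →
  ∑ (λ q → ∑ λ r → ∑ λ s → ∑ λ t → f q r * g s t) ≡ ∑ (λ q → ∑ (f q)) * ∑ (λ s → ∑ (g s))
∑∑-product f g = trans
  (∑-cong λ q → trans
    (∑-cong λ r → trans
      (∑-cong λ s → ∑-* (f q r) (g s))
      (trans (∑-* (f q r) (λ s → ∑ (g s))) (ℤ.*-comm (f q r) (∑ λ s → ∑ (g s)))))
    (∑-* (∑ λ s → ∑ (g s)) (f q)))
  (trans (∑-* (∑ λ s → ∑ (g s)) (λ q → ∑ (f q))) (ℤ.*-comm (∑ λ s → ∑ (g s)) (∑ λ q → ∑ (f q))))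

-- Flag certificates on five vertices

-- Adjacency here is that of the K₄-free graph H; coinciding vertices count as non-adjacent.
PatternFn : Set → Set
PatternFn X = (pq pr ps pt qr qs qt rs rt st : Bool) → X

data Transposition : Set where
  p↔q q↔r r↔s s↔t : Transposition

permute : Transposition → PatternFn ℤ → PatternFn ℤ
permute p↔q g pq pr ps pt qr qs qt rs rt st = g pq qr qs qt pr ps pt rs rt st
permute q↔r g pq pr ps pt qr qs qt rs rt st = g pr pq ps pt qr rs rt qs qt st
permute r↔s g pq pr ps pt qr qs qt rs rt st = g pq ps pr pt qs qr qt rs st rt
permute s↔t g pq pr ps pt qr qs qt rs rt st = g pq pr pt ps qr qt qs rt rs st

act : List Transposition → PatternFn ℤ → PatternFn ℤ
act [] g = g
act (s ∷ w) g = permute s (act w g)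

_⊕_ : PatternFn ℤ → PatternFn ℤ → PatternFn ℤ
(f ⊕ g) pq pr ps pt qr qs qt rs rt st = f pq pr ps pt qr qs qt rs rt st + g pq pr ps pt qr qs qt rs rt st

_⊙_ : ℤ → PatternFn ℤ → PatternFn ℤ
(c ⊙ g) pq pr ps pt qr qs qt rs rt st = c * g pq pr ps pt qr qs qt rs rt st

zeroFn : PatternFn ℤ
zeroFn _ _ _ _ _ _ _ _ _ _ = 0ℤ

symmetrise : List (List Transposition) → PatternFn ℤ → PatternFn ℤ
symmetrise [] g = zeroFn
symmetrise (w ∷ ws) g = act w g ⊕ symmetrise ws g

⟦_⟧ : Bool → ℤ
⟦ true ⟧ = 1ℤ
⟦ false ⟧ = 0ℤ

⟦⟧-nonneg : ∀ b → 0ℤ ≤ ⟦ b ⟧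
⟦⟧-nonneg true = +≤+ z≤n
⟦⟧-nonneg false = +≤+ z≤n

-- Only p, q, r occur, so s and t contribute a factor n² to the totals. What remains is 9 T - n³ for
-- `objective`, and for `deviation` the sum over p of a square, because its two factors share the
-- vertex p.
objective deviation : PatternFn ℤ
objective pq pr _ _ qr _ _ _ _ _ = + 9 * ⟦ not pq ∧ not pr ∧ not qr ⟧ - 1ℤ
deviation pq pr _ _ _ _ _ _ _ _ = (1ℤ - + 3 * ⟦ not pq ⟧) * (1ℤ - + 3 * ⟦ not pr ⟧)

-- Summed over all five vertices, a rooted square gives a sum over p of squares, a typed square a sum over the triples
-- pqr of type τ of squares.
data Square : Set where
  rooted : (Bool → Bool → Bool → ℤ) → Square
  typed : (Bool → Bool → Bool → Bool) → (Bool → Bool → Bool → ℤ) → Square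

square : Square → PatternFn ℤ
square (rooted ℓ) pq pr ps pt qr qs qt rs rt st = ℓ pq pr qr * ℓ ps pt st
square (typed τ ℓ) pq pr ps pt qr qs qt rs rt st = ⟦ τ pq pr qr ⟧ * (ℓ ps qs rs * ℓ pt qt rt)

squares : List (ℕ × Square) → PatternFn ℤ
squares [] = zeroFn
squares ((c , s) ∷ l) = ((+ c) ⊙ square s) ⊕ squares l

-- Coefficients of the six three-vertex flags rooted at p: the subscript counts the neighbours of p
-- among q and r, with v for non-adjacent and w for adjacent q, r. In a complete balanced tripartite
-- graph the mean over q, r is (v₀ + 2 v₂ + 4 w₁ + 2 w₂) / 9, which is zero in every row of
-- `certificate`.
values : (v₀ v₁ v₂ w₀ w₁ w₂ : ℤ) → Bool → Bool → Bool → ℤ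
values v₀ v₁ v₂ w₀ w₁ w₂ false false false = v₀
values v₀ v₁ v₂ w₀ w₁ w₂ false false true  = w₀
values v₀ v₁ v₂ w₀ w₁ w₂ true  true  false = v₂
values v₀ v₁ v₂ w₀ w₁ w₂ true  true  true  = w₂
values v₀ v₁ v₂ w₀ w₁ w₂ _     _     false = v₁
values v₀ v₁ v₂ w₀ w₁ w₂ _     _     true  = w₁

slack : ℕ → ℕ → List (ℕ × Square) → PatternFn ℤ
slack K c l = ((+ K) ⊙ objective) ⊕ (((- + c) ⊙ deviation) ⊕ ((- + 1) ⊙ squares l))

nonneg : ℤ → Bool
nonneg (+ _) = true
nonneg -[1+ _ ] = false

k₄ : PatternFn Bool
k₄ pq pr ps pt qr qs qt rs rt st =
  (pq ∧ pr ∧ ps ∧ qr ∧ qs ∧ rs) ∨ (pq ∧ pr ∧ pt ∧ qr ∧ qt ∧ rt) ∨ (pq ∧ ps ∧ pt ∧ qs ∧ qt ∧ st) ∨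
  (pr ∧ ps ∧ pt ∧ rs ∧ rt ∧ st) ∨ (qr ∧ qs ∧ qt ∧ rs ∧ rt ∧ st)

every : ∀ {k} → (Vec Bool k → Bool) → Bool
every {zero}  φ = φ []
every {suc k} φ = every (λ v → φ (true ∷ v)) ∧ every (λ v → φ (false ∷ v))

every-sound : ∀ {k} (φ : Vec Bool k → Bool) → every φ ≡ true → ∀ v → φ v ≡ true
every-sound {zero} φ h [] = h
every-sound {suc k} φ h (b ∷ v) with every (λ v → φ (true ∷ v)) in eq₁ | every (λ v → φ (false ∷ v)) in eq₂
every-sound {suc k} φ h (true ∷ v)  | true | true = every-sound _ eq₁ v
every-sound {suc k} φ h (false ∷ v) | true | true = every-sound _ eq₂ v

accepts : List (List Transposition) → ℕ → ℕ → List (ℕ × Square) → Vec Bool 10 → Bool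
accepts ws K c l (pq ∷ pr ∷ ps ∷ pt ∷ qr ∷ qs ∷ qt ∷ rs ∷ rt ∷ st ∷ []) =
  k₄ pq pr ps pt qr qs qt rs rt st ∨ nonneg (symmetrise ws (slack K c l) pq pr ps pt qr qs qt rs rt st)

accepts-sound : ∀ ws K c l → every (accepts ws K c l) ≡ true → ∀ pq pr ps pt qr qs qt rs rt st →
  k₄ pq pr ps pt qr qs qt rs rt st ≡ false → 0ℤ ≤ symmetrise ws (slack K c l) pq pr ps pt qr qs qt rs rt st
accepts-sound ws K c l ok pq pr ps pt qr qs qt rs rt st h =
  nonneg-sound x (trans (sym (cong (_∨ nonneg x) h))
    (every-sound (accepts ws K c l) ok (pq ∷ pr ∷ ps ∷ pt ∷ qr ∷ qs ∷ qt ∷ rs ∷ rt ∷ st ∷ [])))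
  where
  x = symmetrise ws (slack K c l) pq pr ps pt qr qs qt rs rt st
  nonneg-sound : ∀ x → nonneg x ≡ true → 0ℤ ≤ x
  nonneg-sound (+ _) _ = +≤+ z≤n

-- Coset representatives suffice to symmetrise, since slack is invariant under q ↔ r and s ↔ t.
cosets : List (List Transposition)
cosets = concatMap (λ u → map (u ++_)
    ([] ∷ (r↔s ∷ []) ∷ (q↔r ∷ r↔s ∷ []) ∷ (s↔t ∷ r↔s ∷ []) ∷ (q↔r ∷ s↔t ∷ r↔s ∷ []) ∷ (r↔s ∷ q↔r ∷ s↔t ∷ r↔s ∷ []) ∷ []))
  ([] ∷ (p↔q ∷ []) ∷ (q↔r ∷ p↔q ∷ []) ∷ (r↔s ∷ q↔r ∷ p↔q ∷ []) ∷ (s↔t ∷ r↔s ∷ q↔r ∷ p↔q ∷ []) ∷ [])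

-- The arguments are the adjacencies of one further vertex to p, q, r. Both squares vanish in
-- complete tripartite graphs: the type used with `ℓ₃₁`, an edge qr and a vertex p adjacent to
-- neither end, does not occur there, and in the type used with `ℓ₃₂` the vertices q and r lie in
-- one part and have equal neighbourhoods.
ℓ₃₁ ℓ₃₂ : Bool → Bool → Bool → ℤ
ℓ₃₁ p false false = if p then 0ℤ else - + 3
ℓ₃₁ p true  true  = if p then + 11 else + 10
ℓ₃₁ p _     _     = if p then - + 4 else - + 7
ℓ₃₂ p q r = (⟦ q ⟧ - ⟦ r ⟧) * (+ 2 - + 3 * ⟦ p ⟧)

-- Rounded from a numerical solution of the semidefinite program; equality in complete balanced tripartite graphs forces
-- every square to vanish there.
certificate : List (ℕ × Square)
certificate =
  (250478 , rooted (values (- + 14) (- + 5) (+ 22) (+ 4) (+ 4) (- + 23)))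
  ∷ (261900 , rooted (values (+ 0) (+ 9) (- + 9) (- + 9) (+ 0) (+ 9)))
  ∷ (90570 , rooted (values (- + 10) (- + 10) (+ 26) (+ 8) (- + 1) (- + 19)))
  ∷ (295084 , rooted (values (- + 8) (- + 8) (+ 1) (+ 1) (+ 10) (- + 17)))
  ∷ (269816 , rooted (values (+ 0) (+ 9) (+ 9) (- + 9) (- + 9) (+ 9)))
  ∷ (52420 , rooted (values (+ 2) (+ 11) (+ 2) (- + 7) (- + 7) (+ 11)))
  ∷ (146720 , rooted (values (- + 6) (+ 3) (+ 3) (- + 6) (- + 6) (+ 12)))
  ∷ (124161 , rooted (values (- + 4) (+ 5) (+ 14) (- + 4) (- + 13) (+ 14)))
  ∷ (356482 , rooted (values (- + 14) (+ 13) (+ 4) (- + 14) (- + 5) (+ 13)))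
  ∷ (7570 , rooted (values (- + 10) (- + 10) (+ 8) (+ 8) (+ 8) (- + 19)))
  ∷ (10164528 , typed (λ pq pr qr → not pq ∧ not pr ∧ qr) ℓ₃₁)
  ∷ (196478784 , typed (λ pq pr qr → pq ∧ pr ∧ not qr) ℓ₃₂)
  ∷ []

-- Decided by evaluating all 1024 patterns. The check concerns Boolean patterns alone, so it holds
-- for every n and covers tuples with repeated vertices.
certified : every (accepts cosets 19482192 178956 certificate) ≡ true
certified = refl

-- Totals of pattern functions over all five-tuples of vertices

module PatternSums {n : ℕ} (A : Fin n → Fin n → Bool) (A-sym : ∀ i j → A i j ≡ A j i) where

  at : ∀ {X} → PatternFn X → (p q r s t : Fin n) → X
  at g p q r s t = g (A p q) (A p r) (A p s) (A p t) (A q r) (A q s) (A q t) (A r s) (A r t) (A s t)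

  total : PatternFn ℤ → ℤ
  total g = ∑ λ p → ∑ λ q → ∑ λ r → ∑ λ s → ∑ λ t → at g p q r s t

  ∑₅-cong : {f g : (p q r s t : Fin n) → ℤ} → (∀ p q r s t → f p q r s t ≡ g p q r s t) →
    ∑ (λ p → ∑ λ q → ∑ λ r → ∑ λ s → ∑ λ t → f p q r s t) ≡
    ∑ (λ p → ∑ λ q → ∑ λ r → ∑ λ s → ∑ λ t → g p q r s t)
  ∑₅-cong h = ∑-cong λ p → ∑-cong λ q → ∑-cong λ r → ∑-cong λ s → ∑-cong λ t → h p q r s t

  -- Two neighbouring summation variables trade names. The only entry that comes out reversed is the
  -- one between the two transposed vertices, and symmetry of `A` repairs it.
  total-permute : ∀ s g → total (permute s g) ≡ total g
  total-permute p↔q g = trans (∑₅-cong {g = λ p q → at g q p} λ p q r s t →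
      cong (λ b → g b (A q r) (A q s) (A q t) (A p r) (A p s) (A p t) (A r s) (A r t) (A s t)) (A-sym p q))
    (∑-swap λ p q → ∑ λ r → ∑ λ s → ∑ λ t → at g q p r s t)
  total-permute q↔r g = trans (∑₅-cong {g = λ p q r → at g p r q} λ p q r s t →
      cong (λ b → g (A p r) (A p q) (A p s) (A p t) b (A r s) (A r t) (A q s) (A q t) (A s t)) (A-sym q r))
    (∑-cong λ p → ∑-swap λ q r → ∑ λ s → ∑ λ t → at g p r q s t)
  total-permute r↔s g = trans (∑₅-cong {g = λ p q r s → at g p q s r} λ p q r s t →
      cong (λ b → g (A p q) (A p s) (A p r) (A p t) (A q s) (A q r) (A q t) b (A s t) (A r t)) (A-sym r s))
    (∑-cong λ p → ∑-cong λ q → ∑-swap λ r s → ∑ λ t → at g p q s r t)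
  total-permute s↔t g = trans (∑₅-cong {g = λ p q r s t → at g p q r t s} λ p q r s t →
      cong (λ b → g (A p q) (A p r) (A p t) (A p s) (A q r) (A q t) (A q s) (A r t) (A r s) b) (A-sym s t))
    (∑-cong λ p → ∑-cong λ q → ∑-cong λ r → ∑-swap λ s t → at g p q r t s)

  total-act : ∀ w g → total (act w g) ≡ total g
  total-act [] g = refl
  total-act (s ∷ w) g = trans (total-permute s (act w g)) (total-act w g)

  total-⊕ : ∀ f g → total (f ⊕ g) ≡ total f + total g
  total-⊕ f g = trans (∑-cong λ p → trans (∑-cong λ q → trans (∑-cong
     λ r → trans (∑-cong λ s → ∑-+ _ _) (∑-+ _ _)) (∑-+ _ _)) (∑-+ _ _)) (∑-+ _ _)

  total-⊙ : ∀ c g → total (c ⊙ g) ≡ c * total g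
  total-⊙ c g = trans (∑-cong λ p → trans (∑-cong λ q → trans (∑-cong
     λ r → trans (∑-cong λ s → ∑-* c _) (∑-* c _)) (∑-* c _)) (∑-* c _)) (∑-* c _)

  total-zero : total zeroFn ≡ 0ℤ
  total-zero = trans (total-⊙ 0ℤ zeroFn) (ℤ.*-zeroˡ (total zeroFn))

  total-symmetrise : ∀ ws g → total (symmetrise ws g) ≡ + length ws * total g
  total-symmetrise [] g = trans total-zero (sym (ℤ.*-zeroˡ (total g)))
  total-symmetrise (w ∷ ws) g = trans (total-⊕ (act w g) (symmetrise ws g))
    (trans (cong₂ _+_ (total-act w g) (total-symmetrise ws g)) (sym (ℤ.suc-* (+ length ws) (total g))))

  -- With the root p, or the typed triple pqr, held fixed, the remaining sum of products factorises
  -- into the square of one sum.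
  total-square-nonneg : ∀ s → 0ℤ ≤ total (square s)
  total-square-nonneg (rooted ℓ) = ∑-nonneg _ λ p →
    subst (0ℤ ≤_) (sym (∑∑-product (λ q r → ℓ (A p q) (A p r) (A q r)) (λ s t → ℓ (A p s) (A p t) (A s t))))
      (square-nonneg (∑ λ q → ∑ λ r → ℓ (A p q) (A p r) (A q r)))
  total-square-nonneg (typed τ ℓ) = ∑-nonneg _ λ p → ∑-nonneg _ λ q → ∑-nonneg _ λ r →
    let b = ⟦ τ (A p q) (A p r) (A q r) ⟧
        f = λ s → ℓ (A p s) (A q s) (A r s)
    in subst (0ℤ ≤_)
      (sym (trans (∑-cong λ s → ∑-* b λ t → f s * f t) (trans (∑-* b λ s → ∑ λ t → f s * f t) (cong (b *_) (∑-product f f)))))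
      (*-nonneg (⟦⟧-nonneg (τ (A p q) (A p r) (A q r))) (square-nonneg (∑ f)))

  total-squares-nonneg : ∀ l → 0ℤ ≤ total (squares l)
  total-squares-nonneg [] = ℤ.≤-reflexive (sym total-zero)
  total-squares-nonneg ((c , s) ∷ l) = subst (0ℤ ≤_)
    (sym (trans (total-⊕ ((+ c) ⊙ square s) (squares l)) (cong (_+ total (squares l)) (total-⊙ (+ c) (square s)))))
    (ℤ.+-mono-≤ (*-nonneg (+≤+ (z≤n {c})) (total-square-nonneg s)) (total-squares-nonneg l))

  module _ (K₄-free : ∀ p q r s t → at k₄ p q r s t ≡ false)
           (ws : List (List Transposition)) (K c : ℕ) (l : List (ℕ × Square)) (ok : every (accepts ws K c l) ≡ true) where

    -- The slack itself may be negative on single patterns. Symmetrising makes it nonnegative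
    -- pointwise and only multiplies the total by the number of words, a factor that is then
    -- cancelled.
    total-slack-nonneg : .{{ℕ.NonZero (length ws)}} → 0ℤ ≤ total (slack K c l)
    total-slack-nonneg = cancel ws
      (subst (0ℤ ≤_) (total-symmetrise ws (slack K c l))
        (∑-nonneg _ λ p → ∑-nonneg _ λ q → ∑-nonneg _ λ r → ∑-nonneg _ λ s → ∑-nonneg _ λ t →
          accepts-sound ws K c l ok (A p q) (A p r) (A p s) (A p t) (A q r) (A q s) (A q t) (A r s) (A r t) (A s t) (K₄-free p q r s t)))
      where
      cancel : ∀ {x} (ws : List (List Transposition)) .{{_ : ℕ.NonZero (length ws)}} → 0ℤ ≤ + length ws * x → 0ℤ ≤ x
      cancel {x} (w ∷ ws) h = ℤ.*-cancelˡ-≤-pos 0ℤ x (+ suc (length ws))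
        (subst (_≤ + suc (length ws) * x) (sym (ℤ.*-zeroʳ (+ suc (length ws)))) h)

    total-bound : .{{ℕ.NonZero (length ws)}} → + c * total deviation ≤ + K * total objective
    total-bound = ℤ.0≤i-j⇒j≤i (ℤ.≤-trans total-slack-nonneg (ℤ.≤-trans (ℤ.≤-reflexive
      (trans (total-⊕ ((+ K) ⊙ objective) (((- + c) ⊙ deviation) ⊕ ((- + 1) ⊙ squares l)))
       (cong₂ _+_ (total-⊙ (+ K) objective)
        (trans (total-⊕ ((- + c) ⊙ deviation) ((- + 1) ⊙ squares l))
         (cong₂ _+_ (total-⊙ (- + c) deviation) (total-⊙ (- + 1) (squares l)))))))
      (drop (+ K * total objective) (+ c) (total deviation) (total (squares l)) (total-squares-nonneg l))))
      where
      drop : ∀ x c y z → 0ℤ ≤ z → x + ((- c) * y + (- + 1) * z) ≤ x - c * y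
      drop x c y z h = ℤ.≤-trans (ℤ.≤-reflexive (eq x c y z))
          (ℤ.≤-trans (ℤ.+-monoʳ-≤ (x - c * y) (ℤ.neg-mono-≤ h)) (ℤ.≤-reflexive (ℤ.+-identityʳ _)))
        where
        eq : ∀ x c y z → x + ((- c) * y + (- + 1) * z) ≡ (x - c * y) - z
        eq = solve-∀

-- Counting in a graph

module DeviationBound {n : ℕ} (A : Fin n → Fin n → Bool) (A-sym : ∀ i j → A i j ≡ A j i) where
  open PatternSums A A-sym

  private
    n² = + n * + n

  codeg : Fin n → ℤ
  codeg p = ∑ λ q → ⟦ not (A p q) ⟧

  cotriples : ℤ
  cotriples = ∑ λ p → ∑ λ q → ∑ λ r → ⟦ not (A p q) ∧ not (A p r) ∧ not (A q r) ⟧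

  ∑∑-const : (x : ℤ) → ∑ {n} (λ _ → ∑ {n} λ _ → x) ≡ n² * x
  ∑∑-const x = trans (∑-cong λ _ → ∑-const n x) (trans (∑-const n (+ n * x)) (sym (ℤ.*-assoc (+ n) (+ n) x)))

  ∑₃-const* : (f : Fin n → Fin n → Fin n → ℤ) →
    ∑ (λ p → ∑ λ q → ∑ λ r → n² * f p q r) ≡ n² * ∑ (λ p → ∑ λ q → ∑ λ r → f p q r)
  ∑₃-const* f = trans (∑-cong λ p → trans (∑-cong λ q → ∑-* n² (f p q)) (∑-* n² λ q → ∑ (f p q))) (∑-* n² λ p → ∑ λ q → ∑ (f p q))

  total-objective : total objective ≡ n² * (+ 9 * cotriples - n² * + n)
  total-objective = trans (∑-cong λ p → ∑-cong λ q → ∑-cong λ r → ∑∑-const (ω p q r)) (trans (∑₃-const* ω) (cong (n² *_) inner))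
    where
    τ ω : Fin n → Fin n → Fin n → ℤ
    τ p q r = ⟦ not (A p q) ∧ not (A p r) ∧ not (A q r) ⟧
    ω p q r = + 9 * τ p q r - 1ℤ
    affine : ∀ {m} (f : Fin m → ℤ) c → ∑ (λ i → + 9 * f i - c) ≡ + 9 * ∑ f - + m * c
    affine {m} f c = trans (∑-+ (λ i → + 9 * f i) (λ _ → - c))
      (cong₂ _+_ (∑-* (+ 9) f) (trans (∑-const m (- c)) (sym (ℤ.neg-distribʳ-* (+ m) c))))
    inner : ∑ (λ p → ∑ λ q → ∑ λ r → ω p q r) ≡ + 9 * cotriples - n² * + n
    inner = trans (∑-cong λ p → trans (∑-cong λ q → affine (τ p q) 1ℤ) (affine (λ q → ∑ (τ p q)) (+ n * 1ℤ)))
      (trans (affine (λ p → ∑ λ q → ∑ (τ p q)) (+ n * (+ n * 1ℤ))) (eq (+ 9 * cotriples) (+ n)))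
      where
      eq : ∀ x m → x - m * (m * (m * 1ℤ)) ≡ x - m * m * m
      eq = solve-∀

  total-deviation : total deviation ≡ n² * ∑ (λ p → (+ n - + 3 * codeg p) * (+ n - + 3 * codeg p))
  total-deviation = trans (∑-cong λ p → ∑-cong λ q → ∑-cong λ r → ∑∑-const (y p q * y p r))
    (trans (∑₃-const* λ p q r → y p q * y p r)
      (cong (n² *_) (∑-cong λ p → trans (∑-product (y p) (y p)) (cong₂ _*_ (row p) (row p)))))
    where
    y : Fin n → Fin n → ℤ
    y p q = 1ℤ - + 3 * ⟦ not (A p q) ⟧
    row : ∀ p → ∑ (y p) ≡ + n - + 3 * codeg p
    row p = trans (∑-cong λ q → eq ⟦ not (A p q) ⟧) (trans (∑-+ (λ _ → 1ℤ) (λ q → (- + 3) * ⟦ not (A p q) ⟧))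
       (trans (cong₂ _+_ (∑-const n 1ℤ) (∑-* (- + 3) λ q → ⟦ not (A p q) ⟧)) (eq' (+ n) (codeg p))))
       where
       eq : ∀ x → 1ℤ - + 3 * x ≡ 1ℤ + (- + 3) * x
       eq = solve-∀
       eq' : ∀ m x → m * 1ℤ + (- + 3) * x ≡ m - + 3 * x
       eq' = solve-∀

  -- The factor n² contributed by the two free vertices appears on both sides and is cancelled.
  deviation-bound : .{{ℕ.NonZero n}} → (∀ p q r s → A p q ∧ A p r ∧ A p s ∧ A q r ∧ A q s ∧ A r s ≡ false) →
    ∀ ws K c l → .{{ℕ.NonZero (length ws)}} → every (accepts ws K c l) ≡ true →
    + c * ∑ (λ p → (+ n - + 3 * codeg p) * (+ n - + 3 * codeg p)) ≤ + K * (+ 9 * cotriples - n² * + n)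
  deviation-bound K₄-free ws K c l ok = cancel n
      (subst₂ _≤_
        (trans (cong (+ c *_) total-deviation) (comm (+ c) n² _))
        (trans (cong (+ K *_) total-objective) (comm (+ K) n² _))
        (total-bound k₄-free ws K c l ok))
    where
    comm : ∀ x y z → x * (y * z) ≡ y * (x * z)
    comm = solve-∀
    cancel : ∀ n {x y} .{{_ : ℕ.NonZero n}} → + n * + n * x ≤ + n * + n * y → x ≤ y
    cancel (suc n) {x} {y} h = ℤ.*-cancelˡ-≤-pos x y (+ suc n * + suc n) h
    k₄-free : ∀ p q r s t → at k₄ p q r s t ≡ false
    k₄-free p q r s t = cong₂ _∨_ (K₄-free p q r s) (cong₂ _∨_ (K₄-free p q r t) (cong₂ _∨_ (K₄-free p q s t)
      (cong₂ _∨_ (K₄-free p r s t) (K₄-free q r s t))))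

-- Closed degrees, closed triples and triangles of G

∑-zero : ∀ {n} (f : Fin n → ℤ) → (∀ i → f i ≡ 0ℤ) → ∑ f ≡ 0ℤ
∑-zero {n} f h = trans (∑-cong h) (trans (∑-const n 0ℤ) (ℤ.*-zeroʳ (+ n)))

∑-same : ∀ {n} (i : Fin n) → ∑ (λ j → ⟦ ⌊ i Fin.≟ j ⌋ ⟧) ≡ 1ℤ
∑-same {suc n} zero = trans (∑-suc _) (cong (λ x → 1ℤ + x) (∑-zero {n} _ λ _ → refl))
∑-same {suc n} (suc i) = trans (∑-suc _) (trans (ℤ.+-identityˡ _) (trans (∑-cong λ j → cong ⟦_⟧ (shift i j)) (∑-same i)))
  where
  shift : ∀ (i j : Fin n) → ⌊ suc i Fin.≟ suc j ⌋ ≡ ⌊ i Fin.≟ j ⌋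
  shift i j with i Fin.≟ j
  ... | yes _ = refl
  ... | no _ = refl

≟-sym : ∀ {k} (i j : Fin k) → ⌊ i Fin.≟ j ⌋ ≡ ⌊ j Fin.≟ i ⌋
≟-sym i j with i Fin.≟ j | j Fin.≟ i
... | yes _ | yes _ = refl
... | no _  | no _  = refl
... | yes p | no ¬p = ⊥-elim (¬p (sym p))
... | no ¬p | yes p = ⊥-elim (¬p (sym p))

≟-refl : ∀ {k} (i : Fin k) → ⌊ i Fin.≟ i ⌋ ≡ true
≟-refl i with i Fin.≟ i
... | yes _ = refl
... | no ¬p = ⊥-elim (¬p refl)

module GraphSums {n : ℕ} (G : Graph n) where

  same : Fin n → Fin n → Bool
  same i j = ⌊ i Fin.≟ j ⌋

  closed : Fin n → Fin n → Bool
  closed i j = adj G i j ∨ same i j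

  deg : Fin n → ℤ
  deg i = ∑ λ j → ⟦ closed i j ⟧

  triples : ℤ
  triples = ∑ λ i → ∑ λ j → ∑ λ k → ⟦ closed i j ∧ closed i k ∧ closed j k ⟧

  closed-sym : ∀ i j → closed i j ≡ closed j i
  closed-sym i j = cong₂ _∨_ (adj-sym G i j) (≟-sym i j)

  closed-adj : ∀ {i j} → i ≢ j → closed i j ≡ true → Adj G i j
  closed-adj {i} {j} i≢j h with adj G i j | i Fin.≟ j
  ... | true  | _     = refl
  ... | false | yes p = ⊥-elim (i≢j p)

  private
    open-≢ : ∀ {i j} → closed i j ≡ false → i ≢ j × ¬ Adj G i j
    open-≢ {i} {j} h with adj G i j | i Fin.≟ j
    ... | false | no ¬p = ¬p , λ ()

  α⇒K₄-free : αAtMost3 G → ∀ p q r s → not (closed p q) ∧ not (closed p r) ∧ not (closed p s) ∧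
    not (closed q r) ∧ not (closed q s) ∧ not (closed r s) ≡ false
  α⇒K₄-free α p q r s with closed p q in e₁ | closed p r in e₂ | closed p s in e₃ | closed q r in e₄ | closed q s in e₅ | closed r s in e₆
  ... | true  | _     | _     | _     | _     | _     = refl
  ... | false | true  | _     | _     | _     | _     = refl
  ... | false | false | true  | _     | _     | _     = refl
  ... | false | false | false | true  | _     | _     = refl
  ... | false | false | false | false | true  | _     = refl
  ... | false | false | false | false | false | true  = refl
  ... | false | false | false | false | false | false =
    let (d₁ , a₁) = open-≢ e₁ ; (d₂ , a₂) = open-≢ e₂ ; (d₃ , a₃) = open-≢ e₃
        (d₄ , a₄) = open-≢ e₄ ; (d₅ , a₅) = open-≢ e₅ ; (d₆ , a₆) = open-≢ e₆
    in ⊥-elim (α p q r s (d₁ , d₂ , d₃ , d₄ , d₅ , d₆ , a₁ , a₂ , a₃ , a₄ , a₅ , a₆))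

  triples-bound : .{{ℕ.NonZero n}} → αAtMost3 G →
    ∀ ws K c l → .{{ℕ.NonZero (length ws)}} → every (accepts ws K c l) ≡ true →
    + c * ∑ (λ v → (+ n - + 3 * deg v) * (+ n - + 3 * deg v)) ≤ + K * (+ 9 * triples - + n * + n * + n)
  triples-bound α ws K c l ok = subst₂ (λ x y → + c * x ≤ + K * (+ 9 * y - + n * + n * + n))
      (∑-cong λ p → cong (λ x → (+ n - + 3 * x) * (+ n - + 3 * x)) (∑-cong λ q → cong ⟦_⟧ (Bool.not-involutive (closed p q))))
      (∑-cong λ p → ∑-cong λ q → ∑-cong λ r → cong ⟦_⟧ (cong₂ _∧_ (Bool.not-involutive (closed p q))
        (cong₂ _∧_ (Bool.not-involutive (closed p r)) (Bool.not-involutive (closed q r)))))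
      (DeviationBound.deviation-bound (λ i j → not (closed i j)) (λ i j → cong not (closed-sym i j))
        (α⇒K₄-free α) ws K c l ok)

  +count : (f : Fin n → ℕ) → + count f ≡ ∑ (λ i → + f i)
  +count f = trans (cong (λ l → + ListAction.sum l) (map-tabulate id f)) (go f)
    where
    go : ∀ {m} (f : Fin m → ℕ) → + ListAction.sum (tabulate f) ≡ ∑ (λ i → + f i)
    go {zero} f = sym (∑-empty _)
    go {suc m} f = trans (cong (λ x → + f zero + x) (go (f ∘ suc))) (sym (∑-suc _))

  private
    o τ : Fin n → Fin n → Fin n → ℤ
    o i j k = + b2n (lt i j Defs.∧ (lt j k Defs.∧ (adj G i j Defs.∧ (adj G i k Defs.∧ adj G j k))))
    τ i j k = ⟦ adj G i j ∧ adj G i k ∧ adj G j k ⟧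

  +t3 : + t3 G ≡ ∑ (λ i → ∑ λ j → ∑ λ k → o i j k)
  +t3 = trans (+count _) (∑-cong λ i → trans (+count _) (∑-cong λ j → +count _))

  private
    lt-sound : ∀ {i j : Fin n} → lt i j ≡ true → toℕ i ℕ.< toℕ j
    lt-sound h = ℕ.<ᵇ⇒< _ _ (subst T (sym h) _)
    lt-complete : ∀ {i j : Fin n} → toℕ i ℕ.< toℕ j → lt i j ≡ true
    lt-complete {i} {j} h with lt i j | ℕ.<⇒<ᵇ h
    ... | true | _ = refl

    lt-false : ∀ {i j : Fin n} → lt i j ≡ false → ¬ (toℕ i ℕ.< toℕ j)
    lt-false h p with trans (sym h) (lt-complete p)
    ... | ()

    lt-flip : ∀ {i j : Fin n} → i ≢ j → lt j i ≡ not (lt i j)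
    lt-flip {i} {j} i≢j with lt i j in e | lt j i in e'
    ... | true  | true  = ⊥-elim (ℕ.<-asym (lt-sound {i} {j} e) (lt-sound {j} {i} e'))
    ... | true  | false = refl
    ... | false | true  = refl
    ... | false | false = ⊥-elim (i≢j (Fin.toℕ-injective (ℕ.≤-antisym (ℕ.≮⇒≥ (lt-false {j} {i} e')) (ℕ.≮⇒≥ (lt-false {i} {j} e)))))

    lt-trans : ∀ {i j k : Fin n} → lt i j ≡ true → lt j k ≡ true → lt i k ≡ true
    lt-trans {i} {j} {k} h h' = lt-complete {i} {k} (ℕ.<-trans (lt-sound {i} {j} h) (lt-sound {j} {k} h'))

    adj-≢ : ∀ {i j} → adj G i j ≡ true → i ≢ j
    adj-≢ h refl with trans (sym h) (irrefl G _)
    ... | ()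

    τᵇ : Fin n → Fin n → Fin n → Bool
    τᵇ i j k = adj G i j ∧ adj G i k ∧ adj G j k

    ord : Fin n → Fin n → Fin n → ℤ
    ord i j k = ⟦ lt i j ∧ lt j k ⟧

    o≡ord*τ : ∀ i j k → o i j k ≡ ord i j k * τ i j k
    o≡ord*τ i j k = bits (lt i j) (lt j k) (adj G i j) (adj G i k) (adj G j k)
      where
      bits : ∀ x y a b c → + b2n (x Defs.∧ (y Defs.∧ (a Defs.∧ (b Defs.∧ c)))) ≡ ⟦ x ∧ y ⟧ * ⟦ a ∧ b ∧ c ⟧
      bits false _ a b c = sym (ℤ.*-zeroˡ ⟦ a ∧ b ∧ c ⟧)
      bits true false a b c = sym (ℤ.*-zeroˡ ⟦ a ∧ b ∧ c ⟧)
      bits true true false _ _ = refl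
      bits true true true false _ = refl
      bits true true true true false = refl
      bits true true true true true = refl

    τ-swap₂₃ : ∀ i j k → τ i k j ≡ τ i j k
    τ-swap₂₃ i j k = cong ⟦_⟧ (trans (cong (λ b → adj G i k ∧ adj G i j ∧ b) (adj-sym G k j)) (bits (adj G i j) (adj G i k) (adj G j k)))
      where
      bits : ∀ a b c → b ∧ a ∧ c ≡ a ∧ b ∧ c
      bits false false _ = refl
      bits false true _ = refl
      bits true _ _ = refl

    τ-swap₁₂ : ∀ i j k → τ j i k ≡ τ i j k
    τ-swap₁₂ i j k = cong ⟦_⟧ (cong₂ _∧_ (adj-sym G j i) (Bool.∧-comm (adj G j k) (adj G i k)))

    -- The vertices of a triangle are distinct, so exactly one of its six orderings is increasing.
    -- Of the eight outcomes of the three comparisons, transitivity excludes the two cyclic ones; in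
    -- each of the others one summand is 1.
    ord-total : ∀ i j k → τᵇ i j k ≡ true →
      ord i j k + ord i k j + ord j i k + ord j k i + ord k i j + ord k j i ≡ 1ℤ
    ord-total i j k h with adj G i j in e₁ | adj G i k in e₂ | adj G j k in e₃
    ... | true | true | true = flips (lt i j) (lt j k) (lt i k) (lt-flip (adj-≢ e₁)) (lt-flip (adj-≢ e₃)) (lt-flip (adj-≢ e₂))
             (lt-trans {i} {j} {k})
             (λ p q → lt-trans {k} {j} {i} (trans (lt-flip (adj-≢ e₃)) (cong not q)) (trans (lt-flip (adj-≢ e₁)) (cong not p)))
      where
      flips : ∀ x y z {x' y' z'} → x' ≡ not x → y' ≡ not y → z' ≡ not z →
        (x ≡ true → y ≡ true → z ≡ true) → (x ≡ false → y ≡ false → z' ≡ true) →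
        ⟦ x ∧ y ⟧ + ⟦ z ∧ y' ⟧ + ⟦ x' ∧ z ⟧ + ⟦ y ∧ z' ⟧ + ⟦ z' ∧ x ⟧ + ⟦ y' ∧ x' ⟧ ≡ 1ℤ
      flips true  true  true  refl refl refl _ _ = refl
      flips true  true  false refl refl refl t _ with t refl refl
      ... | ()
      flips true  false true  refl refl refl _ _ = refl
      flips true  false false refl refl refl _ _ = refl
      flips false true  true  refl refl refl _ _ = refl
      flips false true  false refl refl refl _ _ = refl
      flips false false true  refl refl refl _ t with t refl refl
      ... | ()
      flips false false false refl refl refl _ _ = refl

    orderings : ∀ i j k → τ i j k ≡ o i j k + o i k j + o j i k + o j k i + o k i j + o k j i
    orderings i j k = trans (expand (τᵇ i j k) (ord-total i j k))
      (trans (distrib (ord i j k) (ord i k j) (ord j i k) (ord j k i) (ord k i j) (ord k j i) (τ i j k))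
        (cong₂ _+_ (cong₂ _+_ (cong₂ _+_ (cong₂ _+_ (cong₂ _+_
          (back i j k refl)
          (back i k j (τ-swap₂₃ i j k)))
          (back j i k (τ-swap₁₂ i j k)))
          (back j k i (trans (τ-swap₂₃ j i k) (τ-swap₁₂ i j k))))
          (back k i j (trans (τ-swap₁₂ i k j) (τ-swap₂₃ i j k))))
          (back k j i (trans (τ-swap₁₂ j k i) (trans (τ-swap₂₃ j i k) (τ-swap₁₂ i j k))))))
      where
      back : ∀ a b c → τ a b c ≡ τ i j k → ord a b c * τ i j k ≡ o a b c
      back a b c h = sym (trans (o≡ord*τ a b c) (cong (ord a b c *_) h))
      expand : ∀ b {x} → (b ≡ true → x ≡ 1ℤ) → ⟦ b ⟧ ≡ x * ⟦ b ⟧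
      expand true h = sym (trans (ℤ.*-identityʳ _) (h refl))
      expand false {x} h = sym (ℤ.*-zeroʳ x)
      distrib : ∀ a b c d e f t → (a + b + c + d + e + f) * t ≡ a * t + b * t + c * t + d * t + e * t + f * t
      distrib = solve-∀

    ∑₃ : (Fin n → Fin n → Fin n → ℤ) → ℤ
    ∑₃ f = ∑ λ i → ∑ λ j → ∑ λ k → f i j k

    ∑₃-+ : ∀ f g → ∑₃ (λ i j k → f i j k + g i j k) ≡ ∑₃ f + ∑₃ g
    ∑₃-+ f g = trans (∑-cong λ i → trans (∑-cong λ j → ∑-+ (f i j) (g i j)) (∑-+ _ _)) (∑-+ _ _)

    ∑₃-swap₁₂ : ∀ f → ∑₃ (λ i j k → f j i k) ≡ ∑₃ f
    ∑₃-swap₁₂ f = ∑-swap λ i j → ∑ (f j i)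

    ∑₃-swap₂₃ : ∀ f → ∑₃ (λ i j k → f i k j) ≡ ∑₃ f
    ∑₃-swap₂₃ f = ∑-cong λ i → ∑-swap λ j k → f i k j

  ∑τ≡6t₃ : ∑ (λ i → ∑ λ j → ∑ λ k → τ i j k) ≡ + 6 * + t3 G
  ∑τ≡6t₃ = trans (∑-cong λ i → ∑-cong λ j → ∑-cong λ k → orderings i j k)
    (trans split (trans (six (∑₃ o)) (cong (+ 6 *_) (sym +t3))))
    where
    six : ∀ x → x + x + x + x + x + x ≡ + 6 * x
    six = solve-∀
    split : ∑₃ (λ i j k → o i j k + o i k j + o j i k + o j k i + o k i j + o k j i) ≡ ∑₃ o + ∑₃ o + ∑₃ o + ∑₃ o + ∑₃ o + ∑₃ o
    split = trans (∑₃-+ _ (λ i j k → o k j i)) (cong₂ _+_ (trans (∑₃-+ _ (λ i j k → o k i j)) (cong₂ _+_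
      (trans (∑₃-+ _ (λ i j k → o j k i)) (cong₂ _+_ (trans (∑₃-+ _ (λ i j k → o j i k)) (cong₂ _+_
      (trans (∑₃-+ o (λ i j k → o i k j)) (cong (λ x → ∑₃ o + x) (∑₃-swap₂₃ o)))
      (∑₃-swap₁₂ o)))
      (trans (∑₃-swap₁₂ (λ i j k → o i k j)) (∑₃-swap₂₃ o))))
      (trans (∑₃-swap₂₃ (λ i j k → o j i k)) (∑₃-swap₁₂ o))))
      (trans (∑₃-swap₁₂ (λ i j k → o k i j)) (trans (∑₃-swap₂₃ (λ i j k → o j i k)) (∑₃-swap₁₂ o))))

  private
    -- The asymmetry prevents overcounting: the diagonal i = j = k is counted by the first
    -- coincidence term only, since irreflexivity makes the other two vanish there.
    triple-split : ∀ i j k → ⟦ closed i j ∧ closed i k ∧ closed j k ⟧ ≡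
      τ i j k + ⟦ same i j ⟧ * ⟦ closed i k ⟧ + ⟦ same j k ⟧ * ⟦ adj G i j ⟧ + ⟦ same i k ⟧ * ⟦ adj G i j ⟧
    triple-split i j k with i Fin.≟ j | i Fin.≟ k | j Fin.≟ k
    ... | yes refl | yes refl | no ¬p = ⊥-elim (¬p refl)
    ... | yes refl | no ¬p | yes refl = ⊥-elim (¬p refl)
    ... | no ¬p | yes refl | yes refl = ⊥-elim (¬p refl)
    ... | yes refl | yes refl | yes refl rewrite irrefl G i = refl
    ... | yes refl | no _ | no _ rewrite irrefl G i = bits (adj G i k)
      where
      bits : ∀ b → ⟦ (b ∨ false) ∧ (b ∨ false) ⟧ ≡ 0ℤ + 1ℤ * ⟦ b ∨ false ⟧ + 0ℤ + 0ℤ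
      bits true = refl
      bits false = refl
    ... | no _ | yes refl | no _ rewrite irrefl G i | adj-sym G j i = bits (adj G i j)
      where
      bits : ∀ b → ⟦ (b ∨ false) ∧ (b ∨ false) ⟧ ≡ ⟦ b ∧ false ⟧ + 0ℤ + 0ℤ * ⟦ b ⟧ + 1ℤ * ⟦ b ⟧
      bits true = refl
      bits false = refl
    ... | no _ | no _ | yes refl rewrite irrefl G j = bits (adj G i j)
      where
      bits : ∀ b → ⟦ (b ∨ false) ∧ (b ∨ false) ∧ true ⟧ ≡ ⟦ b ∧ b ∧ false ⟧ + 0ℤ * ⟦ b ∨ false ⟧ + 1ℤ * ⟦ b ⟧ + 0ℤ * ⟦ b ⟧
      bits true = refl
      bits false = refl
    ... | no _ | no _ | no _ = bits (adj G i j) (adj G i k) (adj G j k)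
      where
      bits : ∀ a b c → ⟦ (a ∨ false) ∧ (b ∨ false) ∧ (c ∨ false) ⟧ ≡
        ⟦ a ∧ b ∧ c ⟧ + 0ℤ * ⟦ b ∨ false ⟧ + 0ℤ * ⟦ a ⟧ + 0ℤ * ⟦ a ⟧
      bits false false _ = refl
      bits false true _ = refl
      bits true false _ = refl
      bits true true true = refl
      bits true true false = refl

  private
    ∑-select : ∀ i x → ∑ (λ j → ⟦ same i j ⟧ * x) ≡ x
    ∑-select i x = trans (∑-cong λ j → ℤ.*-comm ⟦ same i j ⟧ x) (trans (∑-* x λ j → ⟦ same i j ⟧)
      (trans (cong (x *_) (∑-same i)) (ℤ.*-identityʳ x)))

    deg-adj : ∀ i → deg i ≡ 1ℤ + ∑ (λ j → ⟦ adj G i j ⟧)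
    deg-adj i = trans (∑-cong λ j → split i j) (trans (∑-+ (λ j → ⟦ same i j ⟧) (λ j → ⟦ adj G i j ⟧))
      (cong (λ x → x + ∑ λ j → ⟦ adj G i j ⟧) (∑-same i)))
      where
      split : ∀ i j → ⟦ closed i j ⟧ ≡ ⟦ same i j ⟧ + ⟦ adj G i j ⟧
      split i j with i Fin.≟ j | adj G i j in e
      ... | yes refl | true with trans (sym e) (irrefl G i)
      ...   | ()
      split i j | yes _ | false = refl
      split i j | no _  | true = refl
      split i j | no _  | false = refl

  -- The coincidence i = j contributes the sum of the closed degrees; each of the other two
  -- contributes the sum of the open degrees, which is smaller by n.
  triples≡ : triples ≡ + 6 * + t3 G + + 3 * ∑ deg - + 2 * + n
  triples≡ = trans (∑-cong λ i → ∑-cong λ j → ∑-cong λ k → triple-split i j k)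
    (trans (trans (∑₃-+ _ (λ i j k → ⟦ same i k ⟧ * ⟦ adj G i j ⟧)) (cong₂ _+_
           (trans (∑₃-+ _ (λ i j k → ⟦ same j k ⟧ * ⟦ adj G i j ⟧)) (cong₂ _+_
           (trans (∑₃-+ _ (λ i j k → ⟦ same i j ⟧ * ⟦ closed i k ⟧)) (cong₂ _+_ ∑τ≡6t₃ first))
           second)) third))
      (eq (+ 6 * + t3 G) (∑ deg) (∑ λ i → ∑ λ j → ⟦ adj G i j ⟧) (+ n) degs))
    where
    first : ∑₃ (λ i j k → ⟦ same i j ⟧ * ⟦ closed i k ⟧) ≡ ∑ deg
    first = ∑-cong λ i → trans (∑-cong λ j → ∑-* ⟦ same i j ⟧ (λ k → ⟦ closed i k ⟧)) (∑-select i (deg i))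
    second : ∑₃ (λ i j k → ⟦ same j k ⟧ * ⟦ adj G i j ⟧) ≡ ∑ λ i → ∑ λ j → ⟦ adj G i j ⟧
    second = ∑-cong λ i → ∑-cong λ j → ∑-select j ⟦ adj G i j ⟧
    third : ∑₃ (λ i j k → ⟦ same i k ⟧ * ⟦ adj G i j ⟧) ≡ ∑ λ i → ∑ λ j → ⟦ adj G i j ⟧
    third = ∑-cong λ i → ∑-cong λ j → ∑-select i ⟦ adj G i j ⟧
    degs : ∑ deg ≡ + n + ∑ λ i → ∑ λ j → ⟦ adj G i j ⟧
    degs = trans (∑-cong deg-adj) (trans (∑-+ (λ _ → 1ℤ) (λ i → ∑ λ j → ⟦ adj G i j ⟧))
      (cong (λ x → x + ∑ λ i → ∑ λ j → ⟦ adj G i j ⟧) (trans (∑-const n 1ℤ) (ℤ.*-identityʳ (+ n)))))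
    eq : ∀ x g a m → g ≡ m + a → x + g + a + a ≡ x + + 3 * g - + 2 * m
    eq x .(m + a) a m refl = eq' x a m
      where
      eq' : ∀ x a m → x + (m + a) + a + a ≡ x + + 3 * (m + a) - + 2 * m
      eq' = solve-∀

-- Colouring K₄-free graphs of large minimum degree

∑-mono : ∀ {n} {f g : Fin n → ℤ} → (∀ i → f i ≤ g i) → ∑ f ≤ ∑ g
∑-mono {zero} {f} {g} h = ℤ.≤-reflexive (trans (∑-empty f) (sym (∑-empty g)))
∑-mono {suc n} {f} {g} h = subst₂ _≤_ (sym (∑-suc f)) (sym (∑-suc g)) (ℤ.+-mono-≤ (h zero) (∑-mono λ i → h (suc i)))

size : ∀ {n} → (Fin n → Bool) → ℤ
size P = ∑ λ i → ⟦ P i ⟧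

_∖_ : ∀ {n} → (Fin n → Bool) → (Fin n → Bool) → Fin n → Bool
(P ∖ Q) i = P i ∧ not (Q i)

∅ full : ∀ {n} → Fin n → Bool
∅ _ = false
full _ = true

size-∅ : ∀ {n} → size {n} ∅ ≡ 0ℤ
size-∅ {n} = trans (∑-const n 0ℤ) (ℤ.*-zeroʳ (+ n))

size-full : ∀ {n} → size {n} full ≡ + n
size-full {n} = trans (∑-const n 1ℤ) (ℤ.*-identityʳ (+ n))

size-mono₃ : ∀ {n} (P Q₁ Q₂ Q₃ : Fin n → Bool) → (∀ i → ⟦ P i ⟧ ≤ ⟦ Q₁ i ⟧ + ⟦ Q₂ i ⟧ + ⟦ Q₃ i ⟧) →
  size P ≤ size Q₁ + size Q₂ + size Q₃
size-mono₃ P Q₁ Q₂ Q₃ h = ℤ.≤-trans (∑-mono h) (ℤ.≤-reflexive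
  (trans (∑-+ (λ i → ⟦ Q₁ i ⟧ + ⟦ Q₂ i ⟧) (λ i → ⟦ Q₃ i ⟧)) (cong (_+ size Q₃) (∑-+ (λ i → ⟦ Q₁ i ⟧) (λ i → ⟦ Q₂ i ⟧)))))

-- Union bound, in the form used for every greedy choice below. At most three sets ever have to be
-- avoided; `∅` fills vacant places.
find : ∀ {n} (P Q₁ Q₂ Q₃ : Fin n → Bool) → size Q₁ + size Q₂ + size Q₃ < size P →
  ∃[ i ] P i ≡ true × Q₁ i ≡ false × Q₂ i ≡ false × Q₃ i ≡ false
find P Q₁ Q₂ Q₃ h with Fin.any? (λ i → (P i ∧ not (Q₁ i) ∧ not (Q₂ i) ∧ not (Q₃ i)) Bool.≟ true)
... | yes (i , e) = i , bits (P i) (Q₁ i) (Q₂ i) (Q₃ i) e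
  where
  bits : ∀ a b c d → a ∧ not b ∧ not c ∧ not d ≡ true → a ≡ true × b ≡ false × c ≡ false × d ≡ false
  bits true false false false refl = refl , refl , refl , refl
... | no none = ⊥-elim (ℤ.<⇒≱ h (size-mono₃ P Q₁ Q₂ Q₃ λ i → bits (P i) (Q₁ i) (Q₂ i) (Q₃ i) (λ e → none (i , e))))
  where
  0≤ : ∀ {k} → 0ℤ ≤ + k
  0≤ = +≤+ z≤n
  1≤ : ∀ {k} → 1ℤ ≤ + suc k
  1≤ = +≤+ (s≤s z≤n)
  bits : ∀ a b c d → a ∧ not b ∧ not c ∧ not d ≢ true → ⟦ a ⟧ ≤ ⟦ b ⟧ + ⟦ c ⟧ + ⟦ d ⟧
  bits true  true  true  true  _ = 1≤
  bits true  true  true  false _ = 1≤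
  bits true  true  false true  _ = 1≤
  bits true  true  false false _ = 1≤
  bits true  false true  true  _ = 1≤
  bits true  false true  false _ = 1≤
  bits true  false false true  _ = 1≤
  bits true  false false false e = ⊥-elim (e refl)
  bits false true  true  true  _ = 0≤
  bits false true  true  false _ = 0≤
  bits false true  false true  _ = 0≤
  bits false true  false false _ = 0≤
  bits false false true  true  _ = 0≤
  bits false false true  false _ = 0≤
  bits false false false true  _ = 0≤
  bits false false false false _ = 0≤

-- Pattern for the linear and polynomial arithmetic: the difference of the two sides is displayed as
-- a visibly nonnegative expression, and the ring solver confirms the identity.
gap≤ : ∀ {x y z} → y - x ≡ z → 0ℤ ≤ z → x ≤ y
gap≤ e h = ℤ.0≤i-j⇒j≤i (subst (0ℤ ≤_) (sym e) h)

gaps₂ : ∀ {x y a₁ b₁ a₂ b₂} → a₁ ≤ b₁ → a₂ ≤ b₂ → y - x ≡ (b₁ - a₁) + (b₂ - a₂) → x ≤ y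
gaps₂ h₁ h₂ e = gap≤ e (ℤ.+-mono-≤ (ℤ.i≤j⇒0≤j-i h₁) (ℤ.i≤j⇒0≤j-i h₂))

gaps₅ : ∀ {x y a₁ b₁ a₂ b₂ a₃ b₃ a₄ b₄ a₅ b₅} → a₁ ≤ b₁ → a₂ ≤ b₂ → a₃ ≤ b₃ → a₄ ≤ b₄ → a₅ ≤ b₅ →
  y - x ≡ (b₁ - a₁) + (b₂ - a₂) + (b₃ - a₃) + (b₄ - a₄) + (b₅ - a₅) → x ≤ y
gaps₅ h₁ h₂ h₃ h₄ h₅ e = gap≤ e (ℤ.+-mono-≤ (ℤ.+-mono-≤ (ℤ.+-mono-≤ (ℤ.+-mono-≤ (ℤ.i≤j⇒0≤j-i h₁) (ℤ.i≤j⇒0≤j-i h₂))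
  (ℤ.i≤j⇒0≤j-i h₃)) (ℤ.i≤j⇒0≤j-i h₄)) (ℤ.i≤j⇒0≤j-i h₅))

pick : ∀ {n} (P Q₁ Q₂ Q₃ : Fin n → Bool) {s b₁ b₂ b₃} → s ≤ size P → size Q₁ ≤ b₁ → size Q₂ ≤ b₂ → size Q₃ ≤ b₃ →
  b₁ + b₂ + b₃ < s → ∃[ i ] P i ≡ true × Q₁ i ≡ false × Q₂ i ≡ false × Q₃ i ≡ false
pick P Q₁ Q₂ Q₃ hs h₁ h₂ h₃ h = find P Q₁ Q₂ Q₃ (ℤ.≤-<-trans (ℤ.+-mono-≤ (ℤ.+-mono-≤ h₁ h₂) h₃) (ℤ.<-≤-trans h hs))

size-∅≤0 : ∀ {n} → size {n} ∅ ≤ 0ℤ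
size-∅≤0 = ℤ.≤-reflexive size-∅

next : Fin 3 → Fin 3
next zero = suc zero
next (suc zero) = suc (suc zero)
next (suc (suc zero)) = zero

none≤ : ∀ {B δ} → 0ℤ ≤ B → 0ℤ ≤ δ → 0ℤ + 0ℤ + 0ℤ ≤ + 7 * δ + + 2 * B
none≤ {B} {δ} hB hδ = gaps₂ (*-nonneg (+≤+ (z≤n {7})) hδ) (*-nonneg (+≤+ (z≤n {2})) hB) (eq B δ)
  where
  eq : ∀ B δ → (+ 7 * δ + + 2 * B) - (0ℤ + 0ℤ + 0ℤ) ≡ (+ 7 * δ - 0ℤ) + (+ 2 * B - 0ℤ)
  eq = solve-∀

one≤ : ∀ {B δ} → 0ℤ ≤ B → 0ℤ ≤ δ → B + 0ℤ + 0ℤ ≤ + 7 * δ + + 2 * B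
one≤ {B} {δ} hB hδ = gaps₂ (*-nonneg (+≤+ (z≤n {7})) hδ) hB (eq B δ)
  where
  eq : ∀ B δ → (+ 7 * δ + + 2 * B) - (B + 0ℤ + 0ℤ) ≡ (+ 7 * δ - 0ℤ) + (B - 0ℤ)
  eq = solve-∀

two≤ : ∀ B {δ} → 0ℤ ≤ δ → B + B + 0ℤ ≤ + 7 * δ + + 2 * B
two≤ B {δ} hδ = gap≤ (eq B δ) (*-nonneg (+≤+ (z≤n {7})) hδ)
  where
  eq : ∀ B δ → (+ 7 * δ + + 2 * B) - (B + B + 0ℤ) ≡ + 7 * δ
  eq = solve-∀

cover≤ : ∀ v {a b B} → a ≤ B → b ≤ B → v + a + b ≤ v + + 2 * B
cover≤ v {a} {b} {B} ha hb = gaps₂ ha hb (eq v a b B)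
  where
  eq : ∀ v a b B → (v + + 2 * B) - (v + a + b) ≡ (B - a) + (B - b)
  eq = solve-∀

outside≤ : ∀ {o s m f B n δ ε} → f ≤ ε → m ≤ B → n ≤ s + + 2 * B → + 3 * B ≤ n + δ → o + s ≤ m + f → o ≤ δ + ε
outside≤ {o} {s} {m} {f} {B} {n} {δ} {ε} h₁ h₂ h₃ h₄ h₅ = gaps₅ h₁ h₂ h₃ h₄ h₅ (eq o s m f B n δ ε)
  where
  eq : ∀ o s m f B n δ ε → (δ + ε) - o ≡ (ε - f) + (B - m) + ((s + + 2 * B) - n) + ((n + δ) - + 3 * B) + ((m + f) - (o + s))
  eq = solve-∀

0≤2δ : ∀ {δ} → 0ℤ ≤ δ → 0ℤ + 0ℤ + 0ℤ ≤ + 2 * δ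
0≤2δ {δ} h = *-nonneg (+≤+ (z≤n {2})) h

δ≤2δ : ∀ {δ} → 0ℤ ≤ δ → δ + 0ℤ + 0ℤ ≤ + 2 * δ
δ≤2δ {δ} h = gap≤ (eq δ) h
  where
  eq : ∀ δ → + 2 * δ - (δ + 0ℤ + 0ℤ) ≡ δ
  eq = solve-∀

δ+δ≤2δ : ∀ δ → δ + δ + 0ℤ ≤ + 2 * δ
δ+δ≤2δ δ = ℤ.≤-reflexive (eq δ)
  where
  eq : ∀ δ → δ + δ + 0ℤ ≡ + 2 * δ
  eq = solve-∀

6δ≤7δ : ∀ {δ} → 0ℤ ≤ δ → (δ + + 2 * δ) + (δ + + 2 * δ) + 0ℤ ≤ + 7 * δ
6δ≤7δ {δ} h = gap≤ (eq δ) h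
  where
  eq : ∀ δ → + 7 * δ - ((δ + + 2 * δ) + (δ + + 2 * δ) + 0ℤ) ≡ δ
  eq = solve-∀

7δ≤7δ : ∀ δ → (δ + + 2 * δ) + (δ + + 2 * δ) + δ ≤ + 7 * δ
7δ≤7δ δ = ℤ.≤-reflexive (eq δ)
  where
  eq : ∀ δ → (δ + + 2 * δ) + (δ + + 2 * δ) + δ ≡ + 7 * δ
  eq = solve-∀

shift≤ : ∀ {n s B} → n ≤ s + + 2 * B → n - + 2 * B ≤ s
shift≤ {n} {s} {B} h = gap≤ (eq s n B) (ℤ.i≤j⇒0≤j-i h)
  where
  eq : ∀ s n B → s - (n - + 2 * B) ≡ (s + + 2 * B) - n
  eq = solve-∀

shift< : ∀ {x y n} → x + y < n → x < n - y
shift< {x} {y} {n} h = subst (_< n - y) (eq x y) (ℤ.+-monoˡ-< (- y) h)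
  where
  eq : ∀ x y → x + y + - y ≡ x
  eq = solve-∀

-- M is non-adjacency in H.  For w in a part V_i, |M w| ≤ B and V_i ⊆ M w leave at most δ elements of M w outside V_i.
module Colouring {n : ℕ} (M : Fin n → Fin n → Bool) (M-sym : ∀ i j → M i j ≡ M j i)
  (no-K₄ : ∀ p q r s → M p q ≡ false → M p r ≡ false → M p s ≡ false → M q r ≡ false → M q s ≡ false → M r s ≡ false → ⊥)
  (B δ : ℤ) (0≤B : 0ℤ ≤ B) (0≤δ : 0ℤ ≤ δ) (M-small : ∀ v → size (M v) ≤ B) (3B≤n+δ : + 3 * B ≤ + n + δ) (7δ+2B<n : + 7 * δ + + 2 * B < + n) where

  flip : ∀ {i j b} → M i j ≡ b → M j i ≡ b
  flip {i} {j} e = trans (M-sym j i) e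

  record Parts : Set where
    field
      V : Fin 3 → Fin n → Bool
      V-large : ∀ i → + n ≤ size (V i) + + 2 * B
      V-disjoint : ∀ i j w → i ≢ j → V i w ≡ true → V j w ≡ false
      V-closed : ∀ i u w → V i u ≡ true → V i w ≡ true → M u w ≡ true

  -- Greedy choice: two vertices together have at most 2 B < n non-neighbours in H, so a third
  -- vertex adjacent to both is left.
  triangle : ∃[ x ] ∃[ y ] ∃[ z ] M x y ≡ false × M x z ≡ false × M y z ≡ false
  triangle =
    case pick full ∅ ∅ ∅ n≤ size-∅≤0 size-∅≤0 size-∅≤0 (below (none≤ 0≤B 0≤δ)) of λ { (x , _) →
    case pick full (M x) ∅ ∅ n≤ (M-small x) size-∅≤0 size-∅≤0 (below (one≤ 0≤B 0≤δ)) of λ { (y , _ , xy , _) →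
    case pick full (M x) (M y) ∅ n≤ (M-small x) (M-small y) size-∅≤0 (below (two≤ B 0≤δ)) of λ { (z , _ , xz , yz , _) →
    x , y , z , xy , xz , yz }}}
    where
    n≤ : + n ≤ size {n} full
    n≤ = ℤ.≤-reflexive (sym size-full)
    below : ∀ {x} → x ≤ + 7 * δ + + 2 * B → x < + n
    below h = ℤ.≤-<-trans h 7δ+2B<n

  module Apex {x y z : Fin n} (xy : M x y ≡ false) (xz : M x z ≡ false) (yz : M y z ≡ false) where
    t : Fin 3 → Fin n
    t zero = x
    t (suc zero) = y
    t (suc (suc zero)) = z
    t-open : ∀ i → M (t (next i)) (t (next (next i))) ≡ false
    t-open zero = yz
    t-open (suc zero) = flip xz
    t-open (suc (suc zero)) = xy
    V : Fin 3 → Fin n → Bool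
    V i w = not (M (t (next i)) w) ∧ not (M (t (next (next i))) w)
    V-open : ∀ i w → V i w ≡ true → M (t (next i)) w ≡ false × M (t (next (next i))) w ≡ false
    V-open i w h with M (t (next i)) w | M (t (next (next i))) w
    ... | false | false = refl , refl
    cover : ∀ w → M x w ≡ false → M y w ≡ false → M z w ≡ false → ⊥
    cover w xw yw zw = no-K₄ x y z w xy xz xw yz yw zw
    V-large : ∀ i → + n ≤ size (V i) + + 2 * B
    V-large i = ℤ.≤-trans (subst (_≤ size (V i) + size (M (t (next i))) + size (M (t (next (next i))))) size-full
        (size-mono₃ full (V i) (M (t (next i))) (M (t (next (next i)))) λ w → bits (M (t (next i)) w) (M (t (next (next i))) w)))
      (cover≤ (size (V i)) (M-small (t (next i))) (M-small (t (next (next i)))))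
      where
      bits : ∀ a b → 1ℤ ≤ ⟦ not a ∧ not b ⟧ + ⟦ a ⟧ + ⟦ b ⟧
      bits true true = +≤+ (s≤s z≤n)
      bits true false = ℤ.≤-refl
      bits false true = ℤ.≤-refl
      bits false false = ℤ.≤-refl
    -- A vertex in two parts would be adjacent in H to all of x, y, z.
    V-disjoint : ∀ i j w → i ≢ j → V i w ≡ true → V j w ≡ false
    V-disjoint i j w i≢j h with V j w in e
    ... | false = refl
    ... | true = ⊥-elim (clash i j i≢j (V-open i w h) (V-open j w e))
      where
      clash : ∀ i j → i ≢ j → M (t (next i)) w ≡ false × M (t (next (next i))) w ≡ false →
        M (t (next j)) w ≡ false × M (t (next (next j))) w ≡ false → ⊥
      clash zero zero i≢j _ _ = i≢j refl
      clash zero (suc zero) _ (b , c) (_ , a) = cover w a b c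
      clash zero (suc (suc zero)) _ (b , c) (a , _) = cover w a b c
      clash (suc zero) zero _ (_ , a) (b , c) = cover w a b c
      clash (suc zero) (suc zero) i≢j _ _ = i≢j refl
      clash (suc zero) (suc (suc zero)) _ (c , a) (_ , b) = cover w a b c
      clash (suc (suc zero)) zero _ (a , _) (b , c) = cover w a b c
      clash (suc (suc zero)) (suc zero) _ (a , b) (c , _) = cover w a b c
      clash (suc (suc zero)) (suc (suc zero)) i≢j _ _ = i≢j refl
    -- Two vertices of one part that are adjacent in H would form a K₄ with the triangle edge that
    -- defines the part.
    V-closed : ∀ i u w → V i u ≡ true → V i w ≡ true → M u w ≡ true
    V-closed i u w hu hw with M u w in e
    ... | true = refl
    ... | false = ⊥-elim (no-K₄ (t (next i)) (t (next (next i))) u w (t-open i)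
            (proj₁ (V-open i u hu)) (proj₁ (V-open i w hw)) (proj₂ (V-open i u hu)) (proj₂ (V-open i w hw)) e)

    apexParts : Parts
    apexParts = record { V = V ; V-large = V-large ; V-disjoint = V-disjoint ; V-closed = V-closed }

  next-≢ : ∀ i → next i ≢ i × next (next i) ≢ i × next i ≢ next (next i)
  next-≢ zero = (λ ()) , (λ ()) , λ ()
  next-≢ (suc zero) = (λ ()) , (λ ()) , λ ()
  next-≢ (suc (suc zero)) = (λ ()) , (λ ()) , λ ()

  module Colours (P : Parts) where
    open Parts P

    -- Counting the union of `M v` and `V i` in two ways bounds the left side by B + ε - (n - 2 B),
    -- and 3 B - n ≤ δ. So a vertex with few H-neighbours in a part is adjacent to nearly everything
    -- outside that part.
    outside : ∀ i v ε → size (V i ∖ M v) ≤ ε → size (M v ∖ V i) ≤ δ + ε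
    outside i v ε h = outside≤ {δ = δ} h (M-small v) (V-large i) 3B≤n+δ split
      where
      bits : ∀ a b → ⟦ a ∧ not b ⟧ + ⟦ b ⟧ ≡ ⟦ a ⟧ + ⟦ b ∧ not a ⟧
      bits true true = refl
      bits true false = refl
      bits false true = refl
      bits false false = refl
      split : size (M v ∖ V i) + size (V i) ≤ size (M v) + size (V i ∖ M v)
      split = ℤ.≤-reflexive (trans (sym (∑-+ _ _)) (trans (∑-cong λ w → bits (M v w) (V i w)) (∑-+ _ _)))

    outside-V : ∀ i w → V i w ≡ true → size (M w ∖ V i) ≤ δ
    outside-V i w h = subst (size (M w ∖ V i) ≤_) (ℤ.+-identityʳ δ) (outside i w 0ℤ (ℤ.≤-reflexive (trans (∑-cong λ u → cong ⟦_⟧ (none u)) size-∅)))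
      where
      none : ∀ u → V i u ∧ not (M w u) ≡ false
      none u with V i u in e
      ... | false = refl
      ... | true = cong not (V-closed i w u h e)

    private
      ∖-false : ∀ i j u w → i ≢ j → V j w ≡ true → (M u ∖ V i) w ≡ false → M u w ≡ false
      ∖-false i j u w i≢j h e = bits (M u w) (V i w) e (V-disjoint j i w (λ p → i≢j (sym p)) h)
        where
        bits : ∀ a b → a ∧ not b ≡ false → b ≡ false → a ≡ false
        bits false _ _ _ = refl
        bits true false () _
        bits true true _ ()

      ∖-true : ∀ i v w → (V i ∖ M v) w ≡ true → V i w ≡ true × M v w ≡ false
      ∖-true i v w e with V i w | M v w
      ... | true | false = refl , refl

    -- With more than 2 δ neighbours of v in each part, one neighbour per part can be chosen
    -- pairwise adjacent, giving a K₄. The bound 2 δ is set by the last choice, which avoids the at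
    -- most δ outside non-neighbours of each of the two earlier ones.
    some-close : ∀ v → ¬ (size (V zero ∖ M v) ≤ + 2 * δ) → ¬ (size (V (suc zero) ∖ M v) ≤ + 2 * δ) →
      ¬ (size (V (suc (suc zero)) ∖ M v) ≤ + 2 * δ) → ⊥
    some-close v h₀ h₁ h₂ =
      case pick (V zero ∖ M v) ∅ ∅ ∅ ℤ.≤-refl size-∅≤0 size-∅≤0 size-∅≤0 (above h₀ (0≤2δ 0≤δ))
        of λ { (w₀ , p₀ , _) →
      case ∖-true zero v w₀ p₀ of λ { (v₀ , q₀) →
      case pick (V (suc zero) ∖ M v) (M w₀ ∖ V zero) ∅ ∅ ℤ.≤-refl (outside-V zero w₀ v₀) size-∅≤0 size-∅≤0
        (above h₁ (δ≤2δ 0≤δ)) of λ { (w₁ , p₁ , r₀₁ , _) →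
      case ∖-true (suc zero) v w₁ p₁ of λ { (v₁ , q₁) →
      case pick (V (suc (suc zero)) ∖ M v) (M w₀ ∖ V zero) (M w₁ ∖ V (suc zero)) ∅ ℤ.≤-refl
        (outside-V zero w₀ v₀) (outside-V (suc zero) w₁ v₁) size-∅≤0
        (above h₂ (δ+δ≤2δ δ)) of λ { (w₂ , p₂ , r₀₂ , r₁₂ , _) →
      case ∖-true (suc (suc zero)) v w₂ p₂ of λ { (v₂ , q₂) →
      no-K₄ v w₀ w₁ w₂ q₀ q₁ q₂ (∖-false zero (suc zero) w₀ w₁ (λ ()) v₁ r₀₁)
         (∖-false zero (suc (suc zero)) w₀ w₂ (λ ()) v₂ r₀₂) (∖-false (suc zero) (suc (suc zero)) w₁ w₂ (λ ()) v₂ r₁₂) }}}}}}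
      where
      above : ∀ {x y} → ¬ (y ≤ + 2 * δ) → x ≤ + 2 * δ → x < y
      above h h' = ℤ.≤-<-trans h' (ℤ.≰⇒> h)

    -- Colour i is admissible for v if v has at most 2δ neighbours in V_i.
    colour-exists : ∀ v → ∃[ i ] size (V i ∖ M v) ≤ + 2 * δ
    colour-exists v = choose (_ ℤ.≤? _) (_ ℤ.≤? _) (_ ℤ.≤? _)
      where
      choose : Dec (size (V zero ∖ M v) ≤ + 2 * δ) → Dec (size (V (suc zero) ∖ M v) ≤ + 2 * δ) →
        Dec (size (V (suc (suc zero)) ∖ M v) ≤ + 2 * δ) → ∃[ i ] size (V i ∖ M v) ≤ + 2 * δ
      choose (yes h) _ _ = zero , h
      choose (no _) (yes h) _ = suc zero , h
      choose (no _) (no _) (yes h) = suc (suc zero) , h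
      choose (no h₀) (no h₁) (no h₂) = ⊥-elim (some-close v h₀ h₁ h₂)

    -- An H-edge uv inside a colour class extends to a K₄ by one vertex from each of the other two
    -- parts. Outside `V i`, both u and v miss at most 3 δ vertices, and the first chosen vertex
    -- misses at most δ outside its own part: this is the 7 δ that must fit into a part of size at
    -- least n - 2 B.
    not-open : ∀ i u v → size (V i ∖ M u) ≤ + 2 * δ → size (V i ∖ M v) ≤ + 2 * δ → M u v ≡ false → ⊥
    not-open i u v hu hv e = case next-≢ i of λ { (j≢i , k≢i , j≢k) →
      case pick (V (next i)) (M u ∖ V i) (M v ∖ V i) ∅ (large (next i)) (outside i u (+ 2 * δ) hu) (outside i v (+ 2 * δ) hv)
        size-∅≤0 (below (6δ≤7δ 0≤δ)) of λ { (w , w∈ , uw , vw , _) →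
      case pick (V (next (next i))) (M u ∖ V i) (M v ∖ V i) (M w ∖ V (next i)) (large (next (next i)))
        (outside i u (+ 2 * δ) hu) (outside i v (+ 2 * δ) hv) (outside-V (next i) w w∈)
        (below (7δ≤7δ δ)) of λ { (w' , w'∈ , uw' , vw' , ww') →
      no-K₄ u v w w' e
        (∖-false i (next i) u w (λ p → j≢i (sym p)) w∈ uw) (∖-false i (next (next i)) u w' (λ p → k≢i (sym p)) w'∈ uw')
        (∖-false i (next i) v w (λ p → j≢i (sym p)) w∈ vw) (∖-false i (next (next i)) v w' (λ p → k≢i (sym p)) w'∈ vw')
        (∖-false (next i) (next (next i)) w w' j≢k w'∈ ww') }}}
      where
      large : ∀ j → + n - + 2 * B ≤ size (V j)
      large j = shift≤ (V-large j)
      below : ∀ {x} → x ≤ + 7 * δ → x < + n - + 2 * B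
      below h = ℤ.≤-<-trans h (shift< 7δ+2B<n)

    proper : ∃[ c ] (∀ u v → c u ≡ c v → M u v ≡ true)
    proper = (λ v → proj₁ (colour-exists v)) , λ u v e →
      Bool.¬-not (not-open _ u v (proj₂ (colour-exists u)) (subst (λ i → size (V i ∖ M v) ≤ + 2 * δ) (sym e) (proj₂ (colour-exists v))))

  colouring : ∃[ c ] (∀ u v → c u ≡ c v → M u v ≡ true)
  colouring = case triangle of λ { (x , y , z , xy , xz , yz) → Colours.proper (Apex.apexParts xy xz yz) }

-- The Turán value

falling₃ : ℤ → ℤ
falling₃ x = x * (x - 1ℤ) * (x - + 2)

2*C₂ : ∀ a → + 2 * + (a C 2) ≡ + a * (+ a - 1ℤ)
2*C₂ zero = refl
2*C₂ (suc a) = trans (cong (λ k → + 2 * + k) (trans (sym (nCk+nC[k+1]≡[n+1]C[k+1] a 1)) (cong (ℕ._+ a C 2) (nC1≡n a))))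
  (trans (ℤ.*-distribˡ-+ (+ 2) (+ a) (+ (a C 2))) (trans (cong (λ x → + 2 * + a + x) (2*C₂ a)) (eq (+ a))))
  where
  eq : ∀ a → + 2 * a + a * (a - 1ℤ) ≡ (1ℤ + a) * (1ℤ + a - 1ℤ)
  eq = solve-∀

6*C₃ : ∀ a → + 6 * + (a C 3) ≡ falling₃ (+ a)
6*C₃ zero = refl
6*C₃ (suc a) = trans (cong (λ k → + 6 * + k) (sym (nCk+nC[k+1]≡[n+1]C[k+1] a 2)))
  (trans (eq₁ (+ (a C 2)) (+ (a C 3)))
    (trans (cong₂ (λ x y → + 3 * x + y) (2*C₂ a) (6*C₃ a)) (eq₂ (+ a))))
  where
  eq₁ : ∀ x y → + 6 * (x + y) ≡ + 3 * (+ 2 * x) + + 6 * y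
  eq₁ = solve-∀
  eq₂ : ∀ a → + 3 * (a * (a - 1ℤ)) + a * (a - 1ℤ) * (a - + 2) ≡ (1ℤ + a) * (1ℤ + a - 1ℤ) * (1ℤ + a - + 2)
  eq₂ = solve-∀

data Residue (n : ℕ) : Set where
  residue : ∀ m (r : Fin 3) → n ≡ toℕ r ℕ.+ m ℕ.* 3 → Residue n

residueOf : ∀ n → Residue n
residueOf n = residue (n ℕ./ 3) (fromℕ< (m%n<n n 3))
  (trans (m≡m%n+[m/n]*n n 3) (cong (ℕ._+ n ℕ./ 3 ℕ.* 3) (sym (Fin.toℕ-fromℕ< (m%n<n n 3)))))

div₃ : ∀ r m → (r ℕ.+ m ℕ.* 3) ℕ./ 3 ≡ r ℕ./ 3 ℕ.+ m
div₃ r m = trans (+-distrib-/-∣ʳ r (n∣m*n m)) (cong (r ℕ./ 3 ℕ.+_) (m*n/n≡m m 3))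

+-swapʳ : ∀ a b c → a ℕ.+ b ℕ.+ c ≡ a ℕ.+ c ℕ.+ b
+-swapʳ a b c = trans (ℕ.+-assoc a b c) (trans (cong (a ℕ.+_) (ℕ.+-comm b c)) (sym (ℕ.+-assoc a c b)))

partSize-residue : ∀ r m p → partSize (r ℕ.+ m ℕ.* 3) p ≡ (r ℕ.+ toℕ p) ℕ./ 3 ℕ.+ m
partSize-residue r m zero = trans (div₃ r m) (cong (λ k → k ℕ./ 3 ℕ.+ m) (sym (ℕ.+-identityʳ r)))
partSize-residue r m (suc zero) = trans (cong (ℕ._/ 3) (+-swapʳ r (m ℕ.* 3) 1)) (div₃ (r ℕ.+ 1) m)
partSize-residue r m (suc (suc zero)) = trans (cong (ℕ._/ 3) (+-swapʳ r (m ℕ.* 3) 2)) (div₃ (r ℕ.+ 2) m)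

6*turan : ∀ n → + 6 * + turanValue n ≡
  falling₃ (+ partSize n zero) + falling₃ (+ partSize n (suc zero)) + falling₃ (+ partSize n (suc (suc zero)))
6*turan n = trans (eq (+ (a C 3)) (+ (b C 3)) (+ (c C 3))) (cong₂ _+_ (cong₂ _+_ (6*C₃ a) (6*C₃ b)) (6*C₃ c))
  where
  a = partSize n zero
  b = partSize n (suc zero)
  c = partSize n (suc (suc zero))
  eq : ∀ x y z → + 6 * (x + y + z) ≡ + 6 * x + + 6 * y + + 6 * z
  eq = solve-∀

-- Of the three parts, ρ have size m + 1 and the others size m; the step from m to m + 1 raises
-- `falling₃` by 3 m (m - 1).
turan-tangent : ∀ m (r : Fin 3) → let ρ = toℕ r in
  + 6 * + turanValue (ρ ℕ.+ m ℕ.* 3) ≡ + 3 * falling₃ (+ m) + + 3 * + ρ * (+ m * (+ m - 1ℤ))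
turan-tangent m r = trans (6*turan (ρ ℕ.+ m ℕ.* 3))
    (trans (cong₂ _+_ (cong₂ _+_ (part zero) (part (suc zero))) (part (suc (suc zero)))) (split r))
  where
  ρ = toℕ r
  part : ∀ p → falling₃ (+ partSize (ρ ℕ.+ m ℕ.* 3) p) ≡ falling₃ (+ ((ρ ℕ.+ toℕ p) ℕ./ 3 ℕ.+ m))
  part p = cong (λ k → falling₃ (+ k)) (partSize-residue ρ m p)
  split : ∀ r → falling₃ (+ ((toℕ r ℕ.+ 0) ℕ./ 3 ℕ.+ m)) + falling₃ (+ ((toℕ r ℕ.+ 1) ℕ./ 3 ℕ.+ m)) + falling₃ (+ ((toℕ r ℕ.+ 2) ℕ./ 3 ℕ.+ m))
    ≡ + 3 * falling₃ (+ m) + + 3 * + toℕ r * (+ m * (+ m - 1ℤ))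
  split zero = eq (+ m)
    where
    eq : ∀ m → m * (m - 1ℤ) * (m - + 2) + m * (m - 1ℤ) * (m - + 2) + m * (m - 1ℤ) * (m - + 2)
      ≡ + 3 * (m * (m - 1ℤ) * (m - + 2)) + 0ℤ * (m * (m - 1ℤ))
    eq = solve-∀
  split (suc zero) = eq (+ m)
    where
    eq : ∀ m → m * (m - 1ℤ) * (m - + 2) + m * (m - 1ℤ) * (m - + 2) + (1ℤ + m) * (1ℤ + m - 1ℤ) * (1ℤ + m - + 2)
      ≡ + 3 * (m * (m - 1ℤ) * (m - + 2)) + + 3 * (m * (m - 1ℤ))
    eq = solve-∀
  split (suc (suc zero)) = eq (+ m)
    where
    eq : ∀ m → m * (m - 1ℤ) * (m - + 2) + (1ℤ + m) * (1ℤ + m - 1ℤ) * (1ℤ + m - + 2) + (1ℤ + m) * (1ℤ + m - 1ℤ) * (1ℤ + m - + 2)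
      ≡ + 3 * (m * (m - 1ℤ) * (m - + 2)) + + 6 * (m * (m - 1ℤ))
    eq = solve-∀

-- For n = 3 m the left side equals n³ - 9 n² + 18 n; for remainders 1 and 2 it is n³ - 9 n² + 24 n
-- minus 16 and 20. The coefficient 24 serves all three classes.
turan-bound : ∀ n → + 54 * + turanValue n ≤ + n * + n * + n - + 9 * (+ n * + n) + + 24 * + n
turan-bound n with residueOf n
... | residue m r refl = gap≤ (trans (cong₂ (λ x y → y * y * y - + 9 * (y * y) + + 24 * y - x)
        (trans (eq₉ (+ turanValue (toℕ r ℕ.+ m ℕ.* 3))) (cong (+ 9 *_) (turan-tangent m r)))
        (cong (λ x → + toℕ r + x) (ℤ.pos-* m 3))) (diff r)) (nonneg-slack r)
  where
  extra : Fin 3 → ℤ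
  extra zero = + 18 * + m
  extra (suc zero) = + 16
  extra (suc (suc zero)) = + 20
  nonneg-slack : ∀ r → 0ℤ ≤ extra r
  nonneg-slack zero = *-nonneg (+≤+ (z≤n {18})) (+≤+ (z≤n {m}))
  nonneg-slack (suc zero) = +≤+ z≤n
  nonneg-slack (suc (suc zero)) = +≤+ z≤n
  eq₉ : ∀ t → + 54 * t ≡ + 9 * (+ 6 * t)
  eq₉ = solve-∀
  diff : ∀ r → let y = + toℕ r + + m * + 3 in
    y * y * y - + 9 * (y * y) + + 24 * y - + 9 * (+ 3 * falling₃ (+ m) + + 3 * + toℕ r * (+ m * (+ m - 1ℤ))) ≡ extra r
  diff zero = eq (+ m)
    where
    eq : ∀ m → let y = 0ℤ + m * + 3 in y * y * y - + 9 * (y * y) + + 24 * y - + 9 * (+ 3 * (m * (m - 1ℤ) * (m - + 2)) + 0ℤ * (m * (m - 1ℤ))) ≡ + 18 * m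
    eq = solve-∀
  diff (suc zero) = eq (+ m)
    where
    eq : ∀ m → let y = 1ℤ + m * + 3 in y * y * y - + 9 * (y * y) + + 24 * y - + 9 * (+ 3 * (m * (m - 1ℤ) * (m - + 2)) + + 3 * (m * (m - 1ℤ))) ≡ + 16
    eq = solve-∀
  diff (suc (suc zero)) = eq (+ m)
    where
    eq : ∀ m → let y = + 2 + m * + 3 in y * y * y - + 9 * (y * y) + + 24 * y - + 9 * (+ 3 * (m * (m - 1ℤ) * (m - + 2)) + + 6 * (m * (m - 1ℤ))) ≡ + 20
    eq = solve-∀

-- The degree bound

term≤∑ : ∀ {n} (f : Fin n → ℤ) → (∀ i → 0ℤ ≤ f i) → ∀ i → f i ≤ ∑ f
term≤∑ f h zero = subst₂ _≤_ (ℤ.+-identityʳ (f zero)) (sym (∑-suc f))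
  (ℤ.+-monoʳ-≤ (f zero) (∑-nonneg _ λ i → h (suc i)))
term≤∑ f h (suc i) = subst₂ _≤_ (ℤ.+-identityˡ (f (suc i))) (sym (∑-suc f))
  (ℤ.+-mono-≤ (h zero) (term≤∑ (λ i → f (suc i)) (λ i → h (suc i)) i))

-- Completing the square: S and Y stand for the sums of y² and y, and c S ≤ K (6 n - 9 Y).
variance≤ : ∀ {c K n S Y} → 0ℤ ≤ c → c * S ≤ K * (+ 6 * n - + 9 * Y) →
  0ℤ ≤ c * c * S + + 18 * c * K * Y + + 81 * K * K * n → c * c * S ≤ (+ 12 * c * K + + 81 * K * K) * n
variance≤ {c} {K} {n} {S} {Y} 0≤c h sq = gap≤ (eq c K n S Y)
    (ℤ.+-mono-≤ (*-nonneg (*-nonneg (+≤+ (z≤n {2})) 0≤c) (ℤ.i≤j⇒0≤j-i h)) sq)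
  where
  eq : ∀ c K n S Y → (+ 12 * c * K + + 81 * K * K) * n - c * c * S ≡
    + 2 * c * (K * (+ 6 * n - + 9 * Y) - c * S) + (c * c * S + + 18 * c * K * Y + + 81 * K * K * n)
  eq = solve-∀

-- Here g is the sum of closed degrees, so n² - 3 g is the sum of all n - 3 m(v). Collecting the -9
-- n² of the Turán bound into that sum leaves nothing else of order above n.
excess≤ : ∀ {t g n} → + 54 * t ≤ n * n * n - + 9 * (n * n) + + 24 * n →
  + 9 * (+ 6 * t + + 3 * g - + 2 * n) - n * n * n ≤ + 6 * n - + 9 * (n * n - + 3 * g)
excess≤ {t} {g} {n} h = gap≤ (eq t g n) (ℤ.i≤j⇒0≤j-i h)
  where
  eq : ∀ t g n → (+ 6 * n - + 9 * (n * n - + 3 * g)) - (+ 9 * (+ 6 * t + + 3 * g - + 2 * n) - n * n * n) ≡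
    (n * n * n - + 9 * (n * n) + + 24 * n) - + 54 * t
  eq = solve-∀

-- If n ≤ -48 y, then n² ≤ 2304 y² ≤ 2304 S, so c² n² ≤ 2304 D n, and cancelling n contradicts the
-- size of n.
deviation-small : ∀ {c D y S} n .{{_ : ℕ.NonZero n}} → y * y ≤ S → 0ℤ ≤ c → c * c * S ≤ D * + n →
  + 2304 * D < c * c * + n → ¬ (+ n ≤ - (+ 48 * y))
deviation-small {c} {D} {y} {S} (suc k) yy 0≤c h big le =
  ℤ.<⇒≱ big (ℤ.*-cancelʳ-≤-pos (c * c * n) (+ 2304 * D) n (gap≤ (eq c D y S n)
    (ℤ.+-mono-≤ (ℤ.+-mono-≤ (*-nonneg (+≤+ (z≤n {2304})) (ℤ.i≤j⇒0≤j-i h))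
      (*-nonneg (*-nonneg (*-nonneg (+≤+ (z≤n {2304})) 0≤c) 0≤c) (ℤ.i≤j⇒0≤j-i yy)))
      (*-nonneg (*-nonneg 0≤c 0≤c) (*-nonneg (ℤ.i≤j⇒0≤j-i le) (ℤ.+-mono-≤ (ℤ.≤-trans 0≤n le) 0≤n))))))
  where
  n = + suc k
  0≤n : 0ℤ ≤ n
  0≤n = +≤+ z≤n
  eq : ∀ c D y S n → + 2304 * D * n - c * c * n * n ≡
    + 2304 * (D * n - c * c * S) + + 2304 * c * c * (S - y * y) + c * c * ((- (+ 48 * y) - n) * (- (+ 48 * y) + n))
  eq = solve-∀

degree-gap : ∀ {n d} → + 49 * n ≤ + 144 * d → n ≤ - (+ 48 * (n - + 3 * d))
degree-gap {n} {d} h = gap≤ (eq n d) (ℤ.i≤j⇒0≤j-i h)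
  where
  eq : ∀ n d → - (+ 48 * (n - + 3 * d)) - n ≡ + 144 * d - + 49 * n
  eq = solve-∀

∑-affine : ∀ {n} a b (f : Fin n → ℤ) → ∑ (λ i → a - b * f i) ≡ + n * a - b * ∑ f
∑-affine {n} a b f = trans (∑-+ (λ _ → a) (λ i → - (b * f i))) (cong₂ _+_ (∑-const n a)
  (trans (∑-cong λ i → ℤ.neg-distribˡ-* b (f i)) (trans (∑-* (- b) f) (sym (ℤ.neg-distribˡ-* b (∑ f))))))

∑-square : ∀ {n} a b (y : Fin n → ℤ) → 0ℤ ≤ a * a * ∑ (λ i → y i * y i) + + 2 * a * b * ∑ y + b * b * + n
∑-square {n} a b y = subst (0ℤ ≤_)
    (trans (∑-cong λ i → eq a b (y i)) (trans (∑-+ (λ i → a * a * (y i * y i) + + 2 * a * b * y i) (λ _ → b * b))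
      (cong₂ _+_ (trans (∑-+ (λ i → a * a * (y i * y i)) (λ i → + 2 * a * b * y i))
        (cong₂ _+_ (∑-* (a * a) (λ i → y i * y i)) (∑-* (+ 2 * a * b) y)))
        (trans (∑-const n (b * b)) (ℤ.*-comm (+ n) (b * b))))))
    (∑-nonneg _ λ i → square-nonneg (a * y i + b))
  where
  eq : ∀ a b y → (a * y + b) * (a * y + b) ≡ a * a * (y * y) + + 2 * a * b * y + b * b
  eq = solve-∀

rearrange : ∀ c K S Y n → c * c * S + + 2 * c * (+ 9 * K) * Y + + 9 * K * (+ 9 * K) * n ≡
  c * c * S + + 18 * c * K * Y + + 81 * K * K * n
rearrange = solve-∀

module _ {n : ℕ} .{{_ : ℕ.NonZero n}} (G : Graph n) (α : αAtMost3 G) (t₃≤ : t3 G ℕ.≤ turanValue n) where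
  open GraphSums G

  private
    y : Fin n → ℤ
    y v = + n - + 3 * deg v

  degree-bound : ∀ ws K c l → .{{ℕ.NonZero (length ws)}} → every (accepts ws K c l) ≡ true →
    + 2304 * (+ 12 * + c * + K + + 81 * + K * + K) < + c * + c * + n → ∀ v → + 144 * deg v < + 49 * + n
  degree-bound ws K c l ok big v = ℤ.≰⇒> λ h →
    deviation-small {c = + c} {D = D} {y = y v} {S = ∑ λ v → y v * y v} n
      (term≤∑ (λ v → y v * y v) (λ v → square-nonneg (y v)) v) (+≤+ z≤n)
      (variance≤ {c = + c} {K = + K} {n = + n} {S = ∑ λ v → y v * y v} {Y = ∑ y} (+≤+ z≤n) upper lower)
      big (degree-gap {+ n} {deg v} h)
    where
    D = + 12 * + c * + K + + 81 * + K * + K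
    upper : + c * ∑ (λ v → y v * y v) ≤ + K * (+ 6 * + n - + 9 * ∑ y)
    upper = ℤ.≤-trans (triples-bound α ws K c l ok) (ℤ.*-monoˡ-≤-nonNeg (+ K)
      (subst₂ (λ T Y → + 9 * T - + n * + n * + n ≤ + 6 * + n - + 9 * Y) (sym triples≡) (sym (∑-affine (+ n) (+ 3) deg))
        (excess≤ {+ t3 G} {∑ deg} {+ n}
          (ℤ.≤-trans (ℤ.*-monoˡ-≤-nonNeg (+ 54) (+≤+ t₃≤)) (turan-bound n)))))
    -- The sum of (c y(v) + 9 K)². The shift 9 K is chosen so that the linear term cancels against 2
    -- c times `upper`.
    lower : 0ℤ ≤ + c * + c * ∑ (λ v → y v * y v) + + 18 * + c * + K * ∑ y + + 81 * + K * + K * + n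
    lower = subst (0ℤ ≤_) (rearrange (+ c) (+ K) (∑ λ v → y v * y v) (∑ y) (+ n)) (∑-square (+ c) (+ 9 * + K) y)

-- With q = n / 72 the colouring lemma applies to B = 25 q and δ = 3 q.
small-part : ∀ {d q ρ} → + 144 * d < + 49 * (ρ + q * + 72) → ρ ≤ + 71 → + 47 ≤ q → d ≤ + 25 * q
small-part {d} {q} {ρ} h hρ hq = ℤ.≮⇒≥ λ lt → ℤ.<⇒≱ h (gap≤ (eq d q ρ)
    (ℤ.+-mono-≤ (ℤ.+-mono-≤ (ℤ.+-mono-≤ (*-nonneg (+≤+ (z≤n {144})) (ℤ.i≤j⇒0≤j-i (ℤ.i<j⇒suc[i]≤j lt)))
      (*-nonneg (+≤+ (z≤n {72})) (ℤ.i≤j⇒0≤j-i hq))) (*-nonneg (+≤+ (z≤n {49})) (ℤ.i≤j⇒0≤j-i hρ))) (+≤+ (z≤n {49}))))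
  where
  eq : ∀ d q ρ → + 144 * d - + 49 * (ρ + q * + 72) ≡
    + 144 * (d - (1ℤ + + 25 * q)) + + 72 * (q - + 47) + + 49 * (+ 71 - ρ) + + 49
  eq = solve-∀

parts≤ : ∀ {q ρ} → 0ℤ ≤ ρ → + 3 * (+ 25 * q) ≤ (ρ + q * + 72) + + 3 * q
parts≤ {q} {ρ} h = gap≤ (eq q ρ) h
  where
  eq : ∀ q ρ → (ρ + q * + 72) + + 3 * q - + 3 * (+ 25 * q) ≡ ρ
  eq = solve-∀

room< : ∀ {q ρ} → 0ℤ ≤ ρ → + 47 ≤ q → + 7 * (+ 3 * q) + + 2 * (+ 25 * q) < ρ + q * + 72
room< {q} {ρ} h hq = ℤ.suc[i]≤j⇒i<j (gap≤ (eq q ρ) (ℤ.+-mono-≤ (ℤ.+-mono-≤ h (ℤ.i≤j⇒0≤j-i hq)) (+≤+ (z≤n {46}))))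
  where
  eq : ∀ q ρ → ρ + q * + 72 - (1ℤ + (+ 7 * (+ 3 * q) + + 2 * (+ 25 * q))) ≡ ρ + (q - + 47) + + 46
  eq = solve-∀

module _ {n : ℕ} (G : Graph n) (α : αAtMost3 G) where
  open GraphSums G

  clique-cover : 3384 ℕ.≤ n → (∀ v → + 144 * deg v < + 49 * + n) → ∃[ c ] (∀ u v → c u ≡ c v → closed u v ≡ true)
  clique-cover large small = Colouring.colouring closed closed-sym no-K₄ (+ 25 * + q) (+ 3 * + q)
      (*-nonneg (+≤+ (z≤n {25})) 0≤q) (*-nonneg (+≤+ (z≤n {3})) 0≤q)
      (λ v → small-part {deg v} {+ q} {+ ρ} (subst (λ k → + 144 * deg v < + 49 * k) n≡ (small v)) (+≤+ ρ≤71) (+≤+ 47≤q))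
      (subst (λ k → + 3 * (+ 25 * + q) ≤ k + + 3 * + q) (sym n≡) (parts≤ {+ q} (+≤+ (z≤n {ρ}))))
      (subst (λ k → + 7 * (+ 3 * + q) + + 2 * (+ 25 * + q) < k) (sym n≡) (room< {+ q} (+≤+ (z≤n {ρ})) (+≤+ 47≤q)))
    where
    q = n ℕ./ 72
    ρ = n ℕ.% 72
    0≤q : 0ℤ ≤ + q
    0≤q = +≤+ z≤n
    n≡ : + n ≡ + ρ + + q * + 72
    n≡ = trans (cong +_ (m≡m%n+[m/n]*n n 72)) (cong (λ k → + ρ + k) (ℤ.pos-* q 72))
    ρ≤71 : ρ ℕ.≤ 71
    ρ≤71 = ℕ.s≤s⁻¹ (m%n<n n 72)
    -- 3384 = 72 · 47. From q = 47 on, the margin 72 q between 49 · 72 q and 144 · 25 q outweighs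
    -- the rounding loss, at most 49 · 71.
    47≤q : 47 ℕ.≤ q
    47≤q = /-monoˡ-≤ 72 large
    no-K₄ : ∀ p q r s → closed p q ≡ false → closed p r ≡ false → closed p s ≡ false → closed q r ≡ false →
      closed q s ≡ false → closed r s ≡ false → ⊥
    no-K₄ p q r s e₁ e₂ e₃ e₄ e₅ e₆ with α⇒K₄-free α p q r s
    ... | h rewrite e₁ | e₂ | e₃ | e₄ | e₅ | e₆ = case h of λ ()

-- Disjoint unions of three cliques

-- For cliques of sizes x, y, z the closed triples number Σ x³ and the closed degrees sum to Σ x².
-- Solving the triple formula for t uses x³ - 3 x² + 2 x = x (x - 1) (x - 2).
count₆ : ∀ {t g n x y z} → x * (x * x) + y * (y * y) + z * (z * z) ≡ + 6 * t + + 3 * g - + 2 * n →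
  g ≡ x * x + y * y + z * z → n ≡ x + y + z → + 6 * t ≡ falling₃ x + falling₃ y + falling₃ z
count₆ {t} {_} {_} {x} {y} {z} e refl refl = trans (eq₁ t _ _) (trans (cong (λ k → k - + 3 * (x * x + y * y + z * z) + + 2 * (x + y + z)) (sym e)) (eq₂ x y z))
  where
  eq₁ : ∀ t g n → + 6 * t ≡ (+ 6 * t + + 3 * g - + 2 * n) - + 3 * g + + 2 * n
  eq₁ = solve-∀
  eq₂ : ∀ x y z → (x * (x * x) + y * (y * y) + z * (z * z)) - + 3 * (x * x + y * y + z * z) + + 2 * (x + y + z) ≡
    x * (x - 1ℤ) * (x - + 2) + y * (y - 1ℤ) * (y - + 2) + z * (z - 1ℤ) * (z - + 2)
  eq₂ = solve-∀

by-checking : ∀ {P : Set} (P? : Dec P) {_ : True P?} → P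
by-checking P? {t} = toWitness t

module Cluster {n : ℕ} (c : Fin n → Fin 3) where

  cluster : Graph n
  cluster = record
    { adj = λ i j → not ⌊ i Fin.≟ j ⌋ ∧ ⌊ c i Fin.≟ c j ⌋
    ; sym = λ i j → cong₂ (λ a b → not a ∧ b) (≟-sym i j) (≟-sym (c i) (c j))
    ; irrefl = λ i → cong (λ a → not a ∧ ⌊ c i Fin.≟ c i ⌋) (≟-refl i)
    }

  open GraphSums cluster

  χ : Fin 3 → Fin n → ℤ
  χ p i = ⟦ ⌊ c i Fin.≟ p ⌋ ⟧

  part : Fin 3 → ℤ
  part p = ∑ (χ p)

  closed≡ : ∀ i j → closed i j ≡ ⌊ c i Fin.≟ c j ⌋
  closed≡ i j with i Fin.≟ j
  ... | no _ = Bool.∨-identityʳ ⌊ c i Fin.≟ c j ⌋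
  ... | yes refl with c i Fin.≟ c i
  ...   | yes _ = refl
  ...   | no ¬p = ⊥-elim (¬p refl)

  private
    over₃ : (Fin 3 → ℤ) → ℤ
    over₃ f = f zero + f (suc zero) + f (suc (suc zero))

    ∑-over₃ : (f : Fin 3 → Fin n → ℤ) → ∑ (λ i → over₃ λ p → f p i) ≡ over₃ λ p → ∑ (f p)
    ∑-over₃ f = trans (∑-+ (λ i → f zero i + f (suc zero) i) (f (suc (suc zero))))
      (cong (_+ ∑ (f (suc (suc zero)))) (∑-+ (f zero) (f (suc zero))))

    over₃-cong : ∀ {f g : Fin 3 → ℤ} → (∀ p → f p ≡ g p) → over₃ f ≡ over₃ g
    over₃-cong h = cong₂ _+_ (cong₂ _+_ (h zero) (h (suc zero))) (h (suc (suc zero)))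

    indicator₁ : ∀ (a : Fin 3) → 1ℤ ≡ over₃ λ p → ⟦ ⌊ a Fin.≟ p ⌋ ⟧
    indicator₁ = by-checking (Fin.all? λ a → _ ℤ.≟ _)

    indicator₂ : ∀ (a b : Fin 3) → ⟦ ⌊ a Fin.≟ b ⌋ ⟧ ≡ over₃ λ p → ⟦ ⌊ a Fin.≟ p ⌋ ⟧ * ⟦ ⌊ b Fin.≟ p ⌋ ⟧
    indicator₂ = by-checking (Fin.all? λ a → Fin.all? λ b → _ ℤ.≟ _)

    indicator₃ : ∀ (a b d : Fin 3) → ⟦ ⌊ a Fin.≟ b ⌋ ∧ ⌊ a Fin.≟ d ⌋ ∧ ⌊ b Fin.≟ d ⌋ ⟧ ≡
      over₃ λ p → ⟦ ⌊ a Fin.≟ p ⌋ ⟧ * (⟦ ⌊ b Fin.≟ p ⌋ ⟧ * ⟦ ⌊ d Fin.≟ p ⌋ ⟧)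
    indicator₃ = by-checking (Fin.all? λ a → Fin.all? λ b → Fin.all? λ d → _ ℤ.≟ _)

  n≡parts : + n ≡ over₃ part
  n≡parts = trans (sym (trans (∑-const n 1ℤ) (ℤ.*-identityʳ (+ n)))) (trans (∑-cong λ i → indicator₁ (c i)) (∑-over₃ χ))

  degrees≡ : ∑ deg ≡ over₃ λ p → part p * part p
  degrees≡ = trans (∑-cong λ i → trans (∑-cong λ j → trans (cong ⟦_⟧ (closed≡ i j)) (indicator₂ (c i) (c j)))
      (∑-over₃ λ p j → χ p i * χ p j))
    (trans (∑-over₃ λ p i → ∑ λ j → χ p i * χ p j) (over₃-cong λ p → ∑-product (χ p) (χ p)))

  triples-parts : triples ≡ over₃ λ p → part p * (part p * part p)
  triples-parts = trans (∑-cong λ i → trans (∑-cong λ j → trans (∑-cong λ k → trans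
        (cong ⟦_⟧ (cong₂ _∧_ (closed≡ i j) (cong₂ _∧_ (closed≡ i k) (closed≡ j k)))) (indicator₃ (c i) (c j) (c k)))
        (∑-over₃ λ p k → χ p i * (χ p j * χ p k)))
      (∑-over₃ λ p j → ∑ λ k → χ p i * (χ p j * χ p k)))
    (trans (∑-over₃ λ p i → ∑ λ j → ∑ λ k → χ p i * (χ p j * χ p k)) (over₃-cong λ p →
      trans (∑-cong λ i → trans (∑-cong λ j → ∑-* (χ p i) (λ k → χ p j * χ p k)) (trans (∑-* (χ p i) (λ j → ∑ λ k → χ p j * χ p k))
        (cong (χ p i *_) (∑-product (χ p) (χ p)))))
      (trans (∑-cong λ i → ℤ.*-comm (χ p i) (part p * part p)) (trans (∑-* (part p * part p) (χ p)) (ℤ.*-comm (part p * part p) (part p))))))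

  6t₃-cluster : + 6 * + t3 cluster ≡ over₃ λ p → falling₃ (part p)
  6t₃-cluster = count₆ {+ t3 cluster} {∑ deg} {+ n} {part zero} {part (suc zero)} {part (suc (suc zero))}
    (trans (sym triples-parts) triples≡) degrees≡ n≡parts

  parts-nonneg : ∀ p → 0ℤ ≤ part p
  parts-nonneg p = ∑-nonneg _ λ i → ⟦⟧-nonneg ⌊ c i Fin.≟ p ⌋

-- Balancing the cliques

consecutive-nonneg : ∀ z → 0ℤ ≤ z * (z - 1ℤ)
consecutive-nonneg (+ zero) = +≤+ z≤n
consecutive-nonneg (+ suc z) = *-nonneg (+≤+ (z≤n {suc z})) (+≤+ (z≤n {z}))
consecutive-nonneg -[1+ z ] = +≤+ z≤n

tangentGap : ℤ → ℤ → ℤ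
tangentGap m x = (x - m) * (x - m - 1ℤ) * (x + + 2 * (m - 1ℤ))

-- The chord of x (x - 1) (x - 2) through m and m + 1 supports it on the integers.
tangent : ∀ m x → falling₃ x ≡ falling₃ m + + 3 * (x - m) * (m * (m - 1ℤ)) + tangentGap m x
tangent = eq
  where
  eq : ∀ m x → x * (x - 1ℤ) * (x - + 2) ≡ m * (m - 1ℤ) * (m - + 2) + + 3 * (x - m) * (m * (m - 1ℤ)) +
    (x - m) * (x - m - 1ℤ) * (x + + 2 * (m - 1ℤ))
  eq = solve-∀

tangentGap-nonneg : ∀ m {x} → 1ℤ ≤ m → 0ℤ ≤ x → 0ℤ ≤ tangentGap m x
tangentGap-nonneg m {x} hm hx = *-nonneg (consecutive-nonneg (x - m))
  (ℤ.+-mono-≤ hx (*-nonneg (+≤+ (z≤n {2})) (ℤ.i≤j⇒0≤j-i hm)))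

-- For m ≥ 2 the third factor x + 2 (m - 1) is positive, so one of the first two vanishes. For m = 1
-- an empty part would also give zero.
tangentGap-zero : ∀ m {x} → + 2 ≤ m → 0ℤ ≤ x → tangentGap m x ≡ 0ℤ → x ≡ m ⊎ x ≡ 1ℤ + m
tangentGap-zero m {x} hm hx e with ℤ.i*j≡0⇒i≡0∨j≡0 ((x - m) * (x - m - 1ℤ)) e
... | inj₂ z = ⊥-elim (ℤ.<⇒≢ positive (sym z))
  where
  eq : ∀ x m → x + + 2 * (m - 1ℤ) - 1ℤ ≡ x + + 2 * (m - + 2) + 1ℤ
  eq = solve-∀
  positive : 0ℤ < x + + 2 * (m - 1ℤ)
  positive = ℤ.suc[i]≤j⇒i<j (gap≤ (eq x m)
    (ℤ.+-mono-≤ (ℤ.+-mono-≤ hx (*-nonneg (+≤+ (z≤n {2})) (ℤ.i≤j⇒0≤j-i hm))) (+≤+ (z≤n {1}))))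
... | inj₁ z with ℤ.i*j≡0⇒i≡0∨j≡0 (x - m) z
...   | inj₁ z₁ = inj₁ (ℤ.i-j≡0⇒i≡j x m z₁)
...   | inj₂ z₂ = inj₂ (trans (eq x m) (trans (cong (λ k → k + (1ℤ + m)) z₂) (ℤ.+-identityˡ (1ℤ + m))))
  where
  eq : ∀ x m → x ≡ (x - m - 1ℤ) + (1ℤ + m)
  eq = solve-∀

-- The chord values depend only on x + y + z and therefore add up to the Turán value, so the gaps
-- measure exactly the excess over it.
tangent-sum : ∀ {m r x y z T} → x + y + z ≡ r + m * + 3 → T ≡ + 3 * falling₃ m + + 3 * r * (m * (m - 1ℤ)) →
  falling₃ x + falling₃ y + falling₃ z ≡ T + (tangentGap m x + tangentGap m y + tangentGap m z)
tangent-sum {m} {r} {x} {y} {z} e refl = trans (cong₂ _+_ (cong₂ _+_ (tangent m x) (tangent m y)) (tangent m z))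
  (trans (eq₁ (falling₃ m) (m * (m - 1ℤ)) m x y z (tangentGap m x) (tangentGap m y) (tangentGap m z))
    (trans (cong (λ s → + 3 * falling₃ m + + 3 * (s - + 3 * m) * (m * (m - 1ℤ)) + (tangentGap m x + tangentGap m y + tangentGap m z)) e)
      (eq₂ (falling₃ m) (m * (m - 1ℤ)) m r (tangentGap m x + tangentGap m y + tangentGap m z))))
  where
  eq₁ : ∀ F D m x y z a b c → (F + + 3 * (x - m) * D + a) + (F + + 3 * (y - m) * D + b) + (F + + 3 * (z - m) * D + c) ≡
    + 3 * F + + 3 * (x + y + z - + 3 * m) * D + (a + b + c)
  eq₁ = solve-∀
  eq₂ : ∀ F D m r g → + 3 * F + + 3 * (r + m * + 3 - + 3 * m) * D + g ≡ + 3 * F + + 3 * r * D + g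
  eq₂ = solve-∀

zero-terms : ∀ {a b c} → 0ℤ ≤ a → 0ℤ ≤ b → 0ℤ ≤ c → a + b + c ≤ 0ℤ → a ≡ 0ℤ × b ≡ 0ℤ × c ≡ 0ℤ
zero-terms {+ zero} {+ zero} {+ zero} _ _ _ _ = refl , refl , refl
zero-terms {+ suc a} {+ b} {+ c} _ _ _ (+≤+ ())
zero-terms {+ zero} {+ suc b} {+ c} _ _ _ (+≤+ ())
zero-terms {+ zero} {+ zero} {+ suc c} _ _ _ (+≤+ ())

module _ {n : ℕ} (c : Fin n → Fin 3) where
  open Cluster c

  -- The union of cliques is a subgraph of G, so ordered triangles compare term by term; the factor
  -- 6 is cancelled afterwards.
  cluster-t₃≤ : (G : Graph n) → (∀ u v → u ≢ v → c u ≡ c v → Adj G u v) → t3 cluster ℕ.≤ t3 G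
  cluster-t₃≤ G proper = ℤ.drop‿+≤+ (ℤ.*-cancelˡ-≤-pos (+ t3 cluster) (+ t3 G) (+ 6)
    (subst₂ _≤_ (GraphSums.∑τ≡6t₃ cluster) (GraphSums.∑τ≡6t₃ G)
      (∑-mono λ i → ∑-mono λ j → ∑-mono λ k → bits (sub i j) (sub i k) (sub j k))))
    where
    sub : ∀ i j → adj cluster i j ≡ true → adj G i j ≡ true
    sub i j e with i Fin.≟ j | c i Fin.≟ c j
    ... | no i≢j | yes p = proper i j i≢j p
    bits : ∀ {a b d a' b' d'} → (a ≡ true → a' ≡ true) → (b ≡ true → b' ≡ true) → (d ≡ true → d' ≡ true) →
      ⟦ a ∧ b ∧ d ⟧ ≤ ⟦ a' ∧ b' ∧ d' ⟧
    bits {true} {true} {true} ha hb hd rewrite ha refl | hb refl | hd refl = ℤ.≤-refl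
    bits {true} {true} {false} _ _ _ = ⟦⟧-nonneg _
    bits {true} {false} _ _ _ = ⟦⟧-nonneg _
    bits {false} _ _ _ = ⟦⟧-nonneg _

  cluster-α : αAtMost3 cluster
  cluster-α p q r s (pq , pr , ps , qr , qs , rs , ¬pq , ¬pr , ¬ps , ¬qr , ¬qs , ¬rs) =
    pigeon (c p) (c q) (c r) (c s) (differ pq ¬pq , differ pr ¬pr , differ ps ¬ps , differ qr ¬qr , differ qs ¬qs , differ rs ¬rs)
    where
    differ : ∀ {u v} → u ≢ v → ¬ Adj cluster u v → c u ≢ c v
    differ {u} {v} u≢v ¬a e with u Fin.≟ v | c u Fin.≟ c v
    ... | yes p | _ = u≢v p
    ... | no _ | yes _ = ¬a refl
    ... | no _ | no ¬p = ¬p e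
    pigeon : ∀ (a b d e : Fin 3) → ¬ (a ≢ b × a ≢ d × a ≢ e × b ≢ d × b ≢ e × d ≢ e)
    pigeon = by-checking (Fin.all? λ a → Fin.all? λ b → Fin.all? λ d → Fin.all? λ e →
      ¬? (¬? (a Fin.≟ b) ×-dec ¬? (a Fin.≟ d) ×-dec ¬? (a Fin.≟ e) ×-dec ¬? (b Fin.≟ d) ×-dec ¬? (b Fin.≟ e) ×-dec ¬? (d Fin.≟ e)))

  length-part : ∀ p → + length (filter (λ v → c v Fin.≟ p) (allFin n)) ≡ part p
  length-part p = go (λ v → v)
    where
    go : ∀ {m} (f : Fin m → Fin n) → + length (filter (λ v → c v Fin.≟ p) (tabulate f)) ≡ ∑ λ i → χ p (f i)
    go {zero} f = sym (∑-empty _)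
    go {suc m} f with c (f zero) Fin.≟ p in e
    ... | yes _ = trans (cong (λ x → 1ℤ + x) (go λ i → f (suc i))) (sym (trans (∑-suc _) (cong (λ b → ⟦ ⌊ b ⌋ ⟧ + ∑ λ i → χ p (f (suc i))) e)))
    ... | no _ = trans (go λ i → f (suc i)) (sym (trans (∑-suc _) (trans (cong (λ b → ⟦ ⌊ b ⌋ ⟧ + ∑ λ i → χ p (f (suc i))) e) (ℤ.+-identityˡ _))))

cyclic : ∀ {n} → Fin n → Fin 3
cyclic zero = zero
cyclic (suc i) = next (cyclic i)

module _ where
  open Cluster

  -- Removing vertex 0 rotates the colours of the remaining vertices, so the three sizes are proved
  -- in one induction. Colour 0 is used first, so its class is the largest and the order is the
  -- reverse of `partSize`.
  cyclic-parts : ∀ n → part (cyclic {n}) zero ≡ + partSize n (suc (suc zero)) ×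
    part (cyclic {n}) (suc zero) ≡ + partSize n (suc zero) × part (cyclic {n}) (suc (suc zero)) ≡ + partSize n zero
  cyclic-parts zero = ∑-empty _ , ∑-empty _ , ∑-empty _
  cyclic-parts (suc n) = case cyclic-parts n of λ { (h₀ , h₁ , h₂) →
      trans (step zero) (trans (cong (λ x → 1ℤ + x) h₂) (cong +_ (sym wrap))) ,
      trans (step (suc zero)) (trans (ℤ.+-identityˡ _) (trans h₀ (cong (λ k → + (k ℕ./ 3)) (ℕ.+-suc n 1)))) ,
      trans (step (suc (suc zero))) (trans (ℤ.+-identityˡ _) (trans h₁ (cong (λ k → + (k ℕ./ 3)) (ℕ.+-comm n 1)))) }
    where
    wrap : (suc n ℕ.+ 2) ℕ./ 3 ≡ suc (n ℕ./ 3)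
    wrap = trans (cong (ℕ._/ 3) (sym (ℕ.+-suc n 2))) (trans (+-distrib-/-∣ʳ n ∣-refl) (ℕ.+-comm (n ℕ./ 3) 1))
    prev : Fin 3 → Fin 3
    prev p = next (next p)
    shift : ∀ (a p : Fin 3) → ⟦ ⌊ next a Fin.≟ p ⌋ ⟧ ≡ ⟦ ⌊ a Fin.≟ prev p ⌋ ⟧
    shift = by-checking (Fin.all? λ a → Fin.all? λ p → _ ℤ.≟ _)
    step : ∀ p → part (cyclic {suc n}) p ≡ ⟦ ⌊ zero Fin.≟ p ⌋ ⟧ + part (cyclic {n}) (prev p)
    step p = trans (∑-suc _) (cong (λ x → ⟦ ⌊ zero Fin.≟ p ⌋ ⟧ + x) (∑-cong λ i → shift (cyclic i) p))

-- Cyclic relabellings of the colours, with `unrot s` inverse to `rot s`. They are needed because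
-- `ContainsCoTuran3` fixes which colour has which size.
rot unrot : Fin 3 → Fin 3 → Fin 3
rot zero p = p
rot (suc zero) p = next p
rot (suc (suc zero)) p = next (next p)
unrot zero p = p
unrot (suc zero) p = next (next p)
unrot (suc (suc zero)) p = next p

unrot-shift : ∀ s a p → ⟦ ⌊ unrot s a Fin.≟ p ⌋ ⟧ ≡ ⟦ ⌊ a Fin.≟ rot s p ⌋ ⟧
unrot-shift = by-checking (Fin.all? λ s → Fin.all? λ a → Fin.all? λ p → _ ℤ.≟ _)

unrot-injective : ∀ s a b → unrot s a ≡ unrot s b → a ≡ b
unrot-injective = by-checking (Fin.all? λ s → Fin.all? λ a → Fin.all? λ b → (unrot s a Fin.≟ unrot s b) →-dec (a Fin.≟ b))

select : ∀ {X : Set} → X → X → X → Fin 3 → X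
select a b d zero = a
select a b d (suc zero) = b
select a b d (suc (suc zero)) = d

-- The bits mark the parts of size m + 1. Among three bits with sum at most 2, at most one differs
-- from the rest, so a rotation already brings them into increasing order.
rotation : ∀ (r : Fin 3) a b d → ⟦ a ⟧ + ⟦ b ⟧ + ⟦ d ⟧ ≡ + toℕ r →
  ∃[ s ] (∀ p → ⟦ select a b d (rot s p) ⟧ ≡ + ((toℕ r ℕ.+ toℕ p) ℕ./ 3))
rotation zero false false false _ = zero , by-checking (Fin.all? λ p → _ ℤ.≟ _)
rotation zero false false true ()
rotation zero false true false ()
rotation zero false true true ()
rotation zero true false false ()
rotation zero true false true ()
rotation zero true true false ()
rotation zero true true true ()
rotation (suc zero) false false false ()
rotation (suc zero) false false true _ = zero , by-checking (Fin.all? λ p → _ ℤ.≟ _)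
rotation (suc zero) false true false _ = suc (suc zero) , by-checking (Fin.all? λ p → _ ℤ.≟ _)
rotation (suc zero) false true true ()
rotation (suc zero) true false false _ = suc zero , by-checking (Fin.all? λ p → _ ℤ.≟ _)
rotation (suc zero) true false true ()
rotation (suc zero) true true false ()
rotation (suc zero) true true true ()
rotation (suc (suc zero)) false false false ()
rotation (suc (suc zero)) false false true ()
rotation (suc (suc zero)) false true false ()
rotation (suc (suc zero)) false true true _ = zero , by-checking (Fin.all? λ p → _ ℤ.≟ _)
rotation (suc (suc zero)) true false false ()
rotation (suc (suc zero)) true false true _ = suc zero , by-checking (Fin.all? λ p → _ ℤ.≟ _)
rotation (suc (suc zero)) true true false _ = suc (suc zero) , by-checking (Fin.all? λ p → _ ℤ.≟ _)
rotation (suc (suc zero)) true true true ()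

remainders : ∀ {m r} a b d → (a + m) + (b + m) + (d + m) ≡ r + m * + 3 → a + b + d ≡ r
remainders {m} {r} a b d e = trans (eq₁ a b d m) (trans (cong (λ x → x - m * + 3) e) (eq₂ r m))
  where
  eq₁ : ∀ a b d m → a + b + d ≡ (a + m) + (b + m) + (d + m) - m * + 3
  eq₁ = solve-∀
  eq₂ : ∀ r m → r + m * + 3 - m * + 3 ≡ r
  eq₂ = solve-∀

gap-excess : ∀ {T X g} → X ≡ T + g → X ≤ T → g ≤ 0ℤ
gap-excess {T} {X} {g} refl h = gap≤ (eq T g) (ℤ.i≤j⇒0≤j-i h)
  where
  eq : ∀ T g → 0ℤ - g ≡ T - (T + g)
  eq = solve-∀

module Balance {m : ℕ} {r : Fin 3} (2≤m : 2 ℕ.≤ m) (c : Fin (toℕ r ℕ.+ m ℕ.* 3) → Fin 3) where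
  open Cluster c

  private
    n = toℕ r ℕ.+ m ℕ.* 3
    2≤ : + 2 ≤ + m
    2≤ = +≤+ 2≤m
    gap : Fin 3 → ℤ
    gap p = tangentGap (+ m) (part p)
    gap-nonneg : ∀ p → 0ℤ ≤ gap p
    gap-nonneg p = tangentGap-nonneg (+ m) (ℤ.≤-trans (+≤+ (s≤s z≤n)) 2≤) (parts-nonneg p)
    total-parts : part zero + part (suc zero) + part (suc (suc zero)) ≡ + toℕ r + + m * + 3
    total-parts = trans (sym n≡parts) (cong (λ x → + toℕ r + x) (ℤ.pos-* m 3))

  excess : + 6 * + t3 cluster ≡ + 6 * + turanValue n + (gap zero + gap (suc zero) + gap (suc (suc zero)))
  excess = trans 6t₃-cluster (tangent-sum {+ m} {+ toℕ r} {part zero} {part (suc zero)} {part (suc (suc zero))} total-parts (turan-tangent m r))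

  turan≤cluster : turanValue n ℕ.≤ t3 cluster
  turan≤cluster = ℤ.drop‿+≤+ (ℤ.*-cancelˡ-≤-pos (+ turanValue n) (+ t3 cluster) (+ 6)
    (subst (+ 6 * + turanValue n ≤_) (sym excess)
      (subst (_≤ + 6 * + turanValue n + (gap zero + gap (suc zero) + gap (suc (suc zero)))) (ℤ.+-identityʳ (+ 6 * + turanValue n))
        (ℤ.+-monoʳ-≤ (+ 6 * + turanValue n)
          (ℤ.+-mono-≤ (ℤ.+-mono-≤ (gap-nonneg zero) (gap-nonneg (suc zero))) (gap-nonneg (suc (suc zero))))))))

  module _ (t₃≤ : t3 cluster ℕ.≤ turanValue n) where

    gaps-zero : ∀ p → gap p ≡ 0ℤ
    gaps-zero p = case zero-terms (gap-nonneg zero) (gap-nonneg (suc zero)) (gap-nonneg (suc (suc zero)))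
        (gap-excess excess (ℤ.*-monoˡ-≤-nonNeg (+ 6) (+≤+ t₃≤))) of λ { (e₀ , e₁ , e₂) → pick₃ e₀ e₁ e₂ p }
      where
      pick₃ : gap zero ≡ 0ℤ → gap (suc zero) ≡ 0ℤ → gap (suc (suc zero)) ≡ 0ℤ → ∀ p → gap p ≡ 0ℤ
      pick₃ e₀ e₁ e₂ zero = e₀
      pick₃ e₀ e₁ e₂ (suc zero) = e₁
      pick₃ e₀ e₁ e₂ (suc (suc zero)) = e₂

    part-bit : ∀ p → ∃[ b ] part p ≡ ⟦ b ⟧ + + m
    part-bit p = case tangentGap-zero (+ m) 2≤ (parts-nonneg p) (gaps-zero p) of λ
      { (inj₁ e) → false , trans e (sym (ℤ.+-identityˡ (+ m))) ; (inj₂ e) → true , e }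

    balanced : ∃[ s ] (∀ p → Cluster.part (λ v → unrot s (c v)) p ≡ + partSize n p)
    balanced = case part-bit zero of λ { (a , ea) → case part-bit (suc zero) of λ { (b , eb) → case part-bit (suc (suc zero)) of λ { (d , ed) →
      case rotation r a b d (remainders ⟦ a ⟧ ⟦ b ⟧ ⟦ d ⟧
        (trans (sym (cong₂ _+_ (cong₂ _+_ ea eb) ed)) total-parts)) of λ { (s , e) →
      s , λ p → trans (∑-cong λ v → unrot-shift s (c v) p)
        (trans (bits a b d ea eb ed (rot s p)) (trans (cong (λ x → x + + m) (e p)) (cong +_ (sym (partSize-residue (toℕ r) m p))))) }}}}
      where
      bits : ∀ a b d → part zero ≡ ⟦ a ⟧ + + m → part (suc zero) ≡ ⟦ b ⟧ + + m → part (suc (suc zero)) ≡ ⟦ d ⟧ + + m →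
        ∀ p → part p ≡ ⟦ select a b d p ⟧ + + m
      bits a b d ea eb ed zero = ea
      bits a b d ea eb ed (suc zero) = eb
      bits a b d ea eb ed (suc (suc zero)) = ed

-- Graphs covered by three cliques, and the conclusion

module _ {n : ℕ} (8≤n : 8 ℕ.≤ n) (G : Graph n) (c : Fin n → Fin 3) (proper : ∀ u v → u ≢ v → c u ≡ c v → Adj G u v) where

  private
    quotient-large : ∀ {m} (r : Fin 3) → 8 ℕ.≤ toℕ r ℕ.+ m ℕ.* 3 → 2 ℕ.≤ m
    quotient-large {zero} zero ()
    quotient-large {zero} (suc zero) (s≤s ())
    quotient-large {zero} (suc (suc zero)) (s≤s (s≤s ()))
    quotient-large {suc zero} zero (s≤s (s≤s (s≤s ())))
    quotient-large {suc zero} (suc zero) (s≤s (s≤s (s≤s (s≤s ()))))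
    quotient-large {suc zero} (suc (suc zero)) (s≤s (s≤s (s≤s (s≤s (s≤s ())))))
    quotient-large {suc (suc m)} _ _ = s≤s (s≤s z≤n)

  cliques-lower : turanValue n ℕ.≤ t3 G
  cliques-lower with residueOf n
  ... | residue m r refl = ℕ.≤-trans (Balance.turan≤cluster {m} {r} (quotient-large r 8≤n) c) (cluster-t₃≤ c G proper)

  cliques-balanced : t3 G ≡ turanValue n → ContainsCoTuran3 G
  cliques-balanced e with residueOf n
  ... | residue m r refl = case Balance.balanced {m} {r} (quotient-large r 8≤n) c
        (subst (t3 (Cluster.cluster c) ℕ.≤_) e (cluster-t₃≤ c G proper)) of λ { (s , h) →
    (λ v → unrot s (c v)) , (λ p → ℤ.+-injective (trans (length-part (λ v → unrot s (c v)) p) (h p))) ,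
    λ u v u≢v eq → proper u v u≢v (unrot-injective s (c u) (c v) eq) }

cyclic-attains : ∀ n → t3 (Cluster.cluster (cyclic {n})) ≡ turanValue n
cyclic-attains n = case cyclic-parts n of λ { (h₀ , h₁ , h₂) →
  ℤ.+-injective (ℤ.*-cancelˡ-≡ (+ 6) _ _ (trans (Cluster.6t₃-cluster (cyclic {n}))
    (trans (cong₂ _+_ (cong₂ _+_ (cong falling₃ h₀) (cong falling₃ h₁)) (cong falling₃ h₂))
      (trans (reverse₃ (falling₃ (+ partSize n (suc (suc zero)))) (falling₃ (+ partSize n (suc zero))) (falling₃ (+ partSize n zero)))
        (sym (6*turan n)))))) }
  where
  reverse₃ : ∀ x y z → x + y + z ≡ z + y + x
  reverse₃ = solve-∀

-- More than 2304 (12 K c + 81 K²) / c².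
n₀ : ℕ
n₀ = 2500000000

module Large {n : ℕ} (n₀≤n : n₀ ℕ.≤ n) where

  private
    instance
      n-nonZero : ℕ.NonZero n
      n-nonZero = ℕ.>-nonZero (ℕ.≤-trans (ℕ.≤ᵇ⇒≤ 1 n₀ _) n₀≤n)

    8≤n : 8 ℕ.≤ n
    8≤n = ℕ.≤-trans (ℕ.≤ᵇ⇒≤ 8 n₀ _) n₀≤n

    big : + 2304 * (+ 12 * + 178956 * + 19482192 + + 81 * + 19482192 * + 19482192) < + 178956 * + 178956 * + n
    big = ℤ.<-≤-trans {j = + 178956 * + 178956 * + n₀} (by-checking (_ ℤ.<? _)) (ℤ.*-monoˡ-≤-nonNeg (+ 178956 * + 178956) (+≤+ n₀≤n))

  cover : (G : Graph n) → αAtMost3 G → t3 G ℕ.≤ turanValue n → ∃[ c ] (∀ u v → u ≢ v → c u ≡ c v → Adj G u v)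
  cover G α t₃≤ = case clique-cover G α (ℕ.≤-trans (ℕ.≤ᵇ⇒≤ 3384 n₀ _) n₀≤n)
      (degree-bound G α t₃≤ cosets 19482192 178956 certificate certified big) of λ
    { (c , proper) → c , λ u v u≢v e → GraphSums.closed-adj G u≢v (proper u v e) }

  -- A graph with at most the Turán number of triangles is covered by three cliques, and such a
  -- graph has at least that many.
  lower : (G : Graph n) → αAtMost3 G → turanValue n ℕ.≤ t3 G
  lower G α = case ℕ.≤-total (turanValue n) (t3 G) of λ
    { (inj₁ h) → h
    ; (inj₂ h) → case cover G α h of λ { (c , proper) → cliques-lower 8≤n G c proper } }

  extremal : (G : Graph n) → αAtMost3 G → t3 G ≡ turanValue n → ContainsCoTuran3 G
  extremal G α e = case cover G α (ℕ.≤-reflexive e) of λ { (c , proper) → cliques-balanced 8≤n G c proper e }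

theorem5p8 : Σ ℕ (λ n₀ → ∀ (n : ℕ) → n ≥ n₀ →
    IsF34 n (turanValue n) ×
    (∀ (G : Graph n) → αAtMost3 G → t3 G ≡ turanValue n → ContainsCoTuran3 G))
theorem5p8 = n₀ , λ n n₀≤n →
  ((Cluster.cluster cyclic , cluster-α cyclic , cyclic-attains n) , Large.lower n₀≤n) , Large.extremal n₀≤n
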